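{- Let $q_c\approx 2.32472$ be the real root of $x^3-3x^2+2x-1=0$. Then \[ \mathcal{B}_{2^{\aleph_0}}=(1,\infty),\qquad \mathcal{B}_{\aleph_0}=[2,\infty),\qquad \mathcal{B}_k=(q_c,\infty)\ \text{ for every integer } k\ge 2 . \]
   Context: For a real number $q>1$, a $q$-expansion of a real number $x$ is an infinite sequence $(d_i)_{i\ge1}$ with $d_i\in\{0,1,q\}$ for all $i\ge 1$ and $x=\sum_{i=1}^\infty d_i/q^i$ (the digit set $\{0,1,q\}$ depends on the base $q$). Let $E_q$ be the set of real numbers having at least one $q$-expansion. For $k\in\{1,2,3,\dots\}\cup\{\aleph_0,2^{\aleph_0}\}$ let \[ \mathcal{B}_k:=\{q\in(1,\infty): \text{there exists } x\in E_q \text{ with precisely } k \text{ different } q\text{ -expansions}\}, \] where "precisely $k$" means that the set of all $q$-expansions of $x$ has cardinality $k$. -}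

module Defs where

open import Algebra.Bundles using (CommutativeRing; Semiring)
import Algebra.Definitions.RawSemiring as RawSemiringDefinitions
open import Data.Bool.Base using (Bool)
open import Data.Fin.Base using (Fin; toℕ)
open import Data.Nat.Base as ℕ using (ℕ; suc)
open import Data.Product.Base using (Σ; ∃; _×_; proj₁)
open import Data.Sum.Base using (_⊎_)
open import Function.Bundles using (Bijection)
open import Level using (0ℓ)
open import Relation.Binary.Bundles using (Setoid)
import Relation.Binary.Construct.On as On
open import Relation.Binary.Core using (Rel)
open import Relation.Binary.PropositionalEquality using (setoid; _→-setoid_)
open import Relation.Binary.Structures using (IsTotalOrder)
open import Relation.Nullary.Negation.Core using (¬_)
open import Relation.Unary using (Pred; _∈_)

-- Dedekind-complete ordered fields. Assuming excluded middle, they are all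
-- isomorphic to the field of real numbers (the Cauchy reals over ℚ are an
-- instance), which is how ℝ is specified here.
record CompleteOrderedField : Set₁ where
  field
    commutativeRing : CommutativeRing 0ℓ 0ℓ

  open CommutativeRing commutativeRing public

  infix  4 _≤_
  infix  8 _⁻¹

  field
    _≤_          : Rel Carrier 0ℓ
    isTotalOrder : IsTotalOrder _≈_ _≤_
    +-monoˡ-≤    : ∀ z {x y} → x ≤ y → x + z ≤ y + z
    *-nonNeg     : ∀ {x y} → 0# ≤ x → 0# ≤ y → 0# ≤ x * y
    0≉1          : ¬ 0# ≈ 1#

    -- The inverse is total; nothing is said about the value of 0# ⁻¹.
    _⁻¹          : Carrier → Carrier
    ⁻¹-cong      : ∀ {x y} → x ≈ y → x ⁻¹ ≈ y ⁻¹
    *-inverseʳ   : ∀ {x} → ¬ x ≈ 0# → x * x ⁻¹ ≈ 1#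

  UpperBound : Pred Carrier 0ℓ → Pred Carrier 0ℓ
  UpperBound P b = ∀ {x} → x ∈ P → x ≤ b

  field
    supremum : (P : Pred Carrier 0ℓ) → ∃ P → ∃ (UpperBound P) →
               ∃ λ s → UpperBound P s × (∀ {b} → b ∈ UpperBound P → s ≤ b)

data Cardinality : Set where
  finite : ℕ → Cardinality
  ℵ₀     : Cardinality
  2^ℵ₀   : Cardinality

⟦_⟧ : Cardinality → Setoid 0ℓ 0ℓ
⟦ finite k ⟧ = setoid (Fin k)
⟦ ℵ₀ ⟧       = setoid ℕ
⟦ 2^ℵ₀ ⟧     = ℕ →-setoid Bool

HasCardinality : Setoid 0ℓ 0ℓ → Cardinality → Set
HasCardinality S κ = Bijection S ⟦ κ ⟧

module Expansions (ℝ : CompleteOrderedField) where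

  open CompleteOrderedField ℝ
  open RawSemiringDefinitions (Semiring.rawSemiring semiring) using (_^_; sum)

  infix  4 _<_
  infixl 7 _/_

  _<_ : Rel Carrier 0ℓ
  x < y = x ≤ y × ¬ x ≈ y

  _/_ : Carrier → Carrier → Carrier
  x / y = x * y ⁻¹

  2# 3# : Carrier
  2# = 1# + 1#
  3# = 2# + 1#

  infix 4 _HasSum_

  _HasSum_ : (ℕ → Carrier) → Carrier → Set
  a HasSum x = ∀ ε → 0# < ε → ∃ λ N → ∀ n → N ℕ.≤ n →
    let r = sum {n} (λ i → a (toℕ i)) - x in (- ε < r) × (r < ε)

  -- A sequence (dᵢ) with i ≥ 1 is stored from index 0, so that d i is the
  -- coefficient of 1 / q ^ suc i.
  IsExpansion : (q x : Carrier) → Pred (ℕ → Carrier) 0ℓ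
  IsExpansion q x d =
    (∀ i → d i ≈ 0# ⊎ d i ≈ 1# ⊎ d i ≈ q) ×
    (λ i → d i / q ^ suc i) HasSum x

  sequenceSetoid : Setoid 0ℓ 0ℓ
  sequenceSetoid = record
    { Carrier       = ℕ → Carrier
    ; _≈_           = λ d e → ∀ i → d i ≈ e i
    ; isEquivalence = record
      { refl  = λ _ → refl
      ; sym   = λ d≈e i → sym (d≈e i)
      ; trans = λ d≈e e≈f i → trans (d≈e i) (e≈f i)
      }
    }

  -- Two expansions are the same when their digits agree.
  expansionSetoid : (q x : Carrier) → Setoid 0ℓ 0ℓ
  expansionSetoid q x =
    On.setoid {B = Σ (ℕ → Carrier) (IsExpansion q x)} sequenceSetoid proj₁

  E : Carrier → Pred Carrier 0ℓ
  E q x = ∃ (IsExpansion q x)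

  𝓑 : Cardinality → Pred Carrier 0ℓ
  𝓑 κ q = 1# < q × ∃ λ x → x ∈ E q × HasCardinality (expansionSetoid q x) κ

  ⟨_,∞⟩ : Carrier → Pred Carrier 0ℓ
  ⟨ a ,∞⟩ q = a < q

  [_,∞⟩ : Carrier → Pred Carrier 0ℓ
  [ a ,∞⟩ q = a ≤ q

  IsRoot : Pred Carrier 0ℓ
  IsRoot x = x ^ 3 - 3# * x ^ 2 + 2# * x - 1# ≈ 0#

{-# OPTIONS --safe #-}

-- Put p = q - 1 and rescale x to X = p x. Reading off a digit d moves X to qX - p d, and
-- a digit sequence is an expansion of x iff this orbit stays in [0, q]; so everything is
-- about the orbits of the expanding maps X ↦ qX, qX - p, q(X - p) in [0, q].
--
-- * The blocks 10 and 0q have equal value, so the value of (10)^∞ has a continuum of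
--   expansions for every q.
-- * For q ≥ 2 the point 1 / (q - 1) is fixed by digit 1, and its expansions are 1^∞,
--   1ⁿ0q^∞ and, for q = 2, 1ⁿq0^∞. For q < 2 every interior point has an orbit to a point
--   where two digits stay in the interior, and a diagonal argument excludes countably
--   many expansions.
-- * With p³ ≤ q, which is q ≤ qc, every interior point has an orbit to a point with
--   two admissible digits, one of which stays in the interior; hence there are infinitely
--   many expansions. With p³ > q the sequence z = (1ᵐq)^∞ is, for large m, the only
--   expansion of its value, and 0 qʲ z has exactly the expansions 1ⁱ 0 qʲ⁻ⁱ z.
module Submission where

open import Defs
open import Algebra.Bundles using (Semiring)
import Algebra.Definitions.RawSemiring as RawSemiringDefinitions
import Algebra.Properties.Monoid.Mult.TCOptimised as MonoidMult
import Algebra.Properties.Ring as RingProperties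
import Algebra.Properties.Semiring.Mult.TCOptimised as SemiringMult
import Algebra.Properties.Semiring.Sum as SemiringSum
import Algebra.Solver.Ring as RingSolver
open import Algebra.Solver.Ring.AlmostCommutativeRing
  using (fromCommutativeRing; _-Raw-AlmostCommutative⟶_)
open import Axiom.ExcludedMiddle using (ExcludedMiddle)
open import Data.Bool.Base using (Bool; true; false; if_then_else_)
open import Data.Empty using (⊥; ⊥-elim)
open import Data.Fin.Base using (Fin; zero; suc; toℕ)
import Data.Fin.Properties as Fin
open import Data.Integer.Base as ℤ using (ℤ; +_; -[1+_])
import Data.Integer.Properties as ℤ
import Data.Maybe.Base as Maybe
open import Data.Nat.Base as ℕ using (ℕ; zero; suc)
import Data.Nat.Properties as ℕ
open import Data.Product.Base using (Σ; ∃; _×_; _,_; proj₁; proj₂)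
open import Data.Sum.Base using (_⊎_; inj₁; inj₂)
open import Function.Base using (_∘_)
open import Function.Bundles using (Bijection; Injection)
import Function.Construct.Composition as Composition
import Function.Construct.Symmetry as Symmetry
open import Function.Properties.Bijection using (Bijection⇒Inverse)
open import Function.Properties.Inverse using (Inverse⇒Bijection)
open import Level using (0ℓ)
open import Relation.Binary.Bundles using (Setoid)
import Relation.Binary.Construct.On as On
open import Relation.Binary.PropositionalEquality as ≡ using (_≡_; _≢_; _≗_; _→-setoid_)
open import Relation.Binary.Structures using (IsTotalOrder)
open import Relation.Nullary using (¬_; Dec; yes; no; dec⇒maybe)
open import Relation.Nullary.Decidable using (decidable-stable)
open import Relation.Unary using (_≐_)

-- Digit 0 is admissible on [0, 1], digit 1 on [p/q, 1 + p/q] and digit q on [p, q]. So two digits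
-- compete on [p/q, 1] and on [p, 1 + p/q], and for p > 1 only digit 1 is possible on the gap (1,
-- p). An orbit in the gap is expanded away from 1 and leaves it below 1 + q(p - 1) = p². If it then
-- misses [p, 1 + p/q], digit q brings it below q(p² - p) = p³ - p, which is at most 1 = q - p
-- exactly when p³ ≤ q: a choice is unavoidable. Conversely, the largest point at which the cycle of
-- (1ᵐq)^∞ uses digit 1 tends to 1 + p²/q² as m grows, and this is less than p exactly when p³ > q.
-- The obstacle is the endpoints 0 and q, each with a single expansion, to which a choice may lead.
-- Infinitely many expansions need only one successor per choice to stay inside, but a diagonal
-- sequence must be able to avoid either digit; at the fixed point 1 this fails as soon as q ≥ 2.

-- Ring identities with integer coefficients.

module IntegerCoefficients (ℝ : CompleteOrderedField) where

  open CompleteOrderedField ℝ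
  open RingProperties ring
  open MonoidMult +-monoid using (×-homo-+; 1+×) renaming (_×_ to infixl 8 _·_)
  open SemiringMult semiring using (×1-homo-*)
  open import Relation.Binary.Reasoning.Setoid setoid

  integer : ℤ → Carrier
  integer (+ n)    = n · 1#
  integer -[1+ n ] = - (suc n · 1#)

  x+y-[x+z]≈y-z : ∀ x y z → (x + y) - (x + z) ≈ y - z
  x+y-[x+z]≈y-z x y z = begin
    (x + y) - (x + z)       ≈⟨ +-cong (+-comm x y) (sym (-‿+-comm x z)) ⟩
    (y + x) + (- x + - z)   ≈⟨ +-assoc y x _ ⟩
    y + (x + (- x + - z))   ≈⟨ +-congˡ (+-assoc x (- x) (- z)) ⟨
    y + ((x + - x) + - z)   ≈⟨ +-congˡ (+-congʳ (-‿inverseʳ x)) ⟩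
    y + (0# + - z)          ≈⟨ +-congˡ (+-identityˡ (- z)) ⟩
    y - z                   ∎

  integer-⊖ : ∀ m n → integer (m ℤ.⊖ n) ≈ m · 1# - n · 1#
  integer-⊖ m zero = begin
    m · 1#       ≈⟨ +-identityʳ _ ⟨
    m · 1# + 0#  ≈⟨ +-congˡ -0#≈0# ⟨
    m · 1# - 0#  ∎
  integer-⊖ zero (suc n) = sym (+-identityˡ _)
  integer-⊖ (suc m) (suc n) = begin
    integer (suc m ℤ.⊖ suc n)          ≡⟨ ≡.cong integer (ℤ.[1+m]⊖[1+n]≡m⊖n m n) ⟩
    integer (m ℤ.⊖ n)                  ≈⟨ integer-⊖ m n ⟩
    m · 1# - n · 1#                    ≈⟨ x+y-[x+z]≈y-z 1# _ _ ⟨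
    (1# + m · 1#) - (1# + n · 1#)      ≈⟨ +-cong (1+× m 1#) (-‿cong (1+× n 1#)) ⟨
    suc m · 1# - suc n · 1#            ∎

  integer-+ : ∀ i j → integer (i ℤ.+ j) ≈ integer i + integer j
  integer-+ (+ m)    (+ n)    = ×-homo-+ 1# m n
  integer-+ (+ m)    -[1+ n ] = integer-⊖ m (suc n)
  integer-+ -[1+ m ] (+ n)    = trans (integer-⊖ n (suc m)) (+-comm _ _)
  integer-+ -[1+ m ] -[1+ n ] = begin
    - (suc (suc (m ℕ.+ n)) · 1#)     ≡⟨ ≡.cong (λ k → - (suc k · 1#)) (ℕ.+-suc m n) ⟨
    - ((suc m ℕ.+ suc n) · 1#)       ≈⟨ -‿cong (×-homo-+ 1# (suc m) (suc n)) ⟩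
    - (suc m · 1# + suc n · 1#)      ≈⟨ -‿+-comm _ _ ⟨
    - (suc m · 1#) - (suc n · 1#)    ∎

  integer-neg : ∀ i → integer (ℤ.- i) ≈ - integer i
  integer-neg (+ zero)  = sym -0#≈0#
  integer-neg (+ suc n) = refl
  integer-neg -[1+ n ]  = sym (-‿involutive _)

  integer-*⁺ : ∀ m j → integer (+ m ℤ.* j) ≈ integer (+ m) * integer j
  integer-*⁺ m (+ n) =
    trans (reflexive (≡.cong integer (≡.sym (ℤ.pos-* m n)))) (×1-homo-* m n)
  integer-*⁺ m -[1+ n ] = begin
    integer (+ m ℤ.* ℤ.- (+ suc n))      ≡⟨ ≡.cong integer (ℤ.neg-distribʳ-* (+ m) (+ suc n)) ⟨
    integer (ℤ.- (+ m ℤ.* + suc n))      ≈⟨ integer-neg (+ m ℤ.* + suc n) ⟩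
    - integer (+ m ℤ.* + suc n)          ≈⟨ -‿cong (integer-*⁺ m (+ suc n)) ⟩
    - (m · 1# * (suc n · 1#))            ≈⟨ -‿distribʳ-* _ _ ⟩
    m · 1# * - (suc n · 1#)              ∎

  integer-* : ∀ i j → integer (i ℤ.* j) ≈ integer i * integer j
  integer-* (+ m)    j = integer-*⁺ m j
  integer-* -[1+ m ] j = begin
    integer (ℤ.- (+ suc m) ℤ.* j)        ≡⟨ ≡.cong integer (ℤ.neg-distribˡ-* (+ suc m) j) ⟨
    integer (ℤ.- (+ suc m ℤ.* j))        ≈⟨ integer-neg (+ suc m ℤ.* j) ⟩
    - integer (+ suc m ℤ.* j)            ≈⟨ -‿cong (integer-*⁺ (suc m) j) ⟩
    - (suc m · 1# * integer j)           ≈⟨ -‿distribˡ-* _ _ ⟩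
    - (suc m · 1#) * integer j           ∎

  -- Lets the ring solver compare coefficients in ℤ, where equality computes. With the optimised
  -- multiples `integer (+ 1)` is `1#` by definition, so that solved equations match goals written
  -- with numerals.
  homomorphism : ℤ.+-*-rawRing -Raw-AlmostCommutative⟶ fromCommutativeRing commutativeRing
  homomorphism = record
    { ⟦_⟧    = integer
    ; +-homo = integer-+
    ; *-homo = integer-*
    ; -‿homo = integer-neg
    ; 0-homo = refl
    ; 1-homo = refl
    }

  open RingSolver ℤ.+-*-rawRing (fromCommutativeRing commutativeRing) homomorphism
    (λ i j → Maybe.map (λ i≡j → reflexive (≡.cong integer i≡j)) (dec⇒maybe (i ℤ.≟ j)))
    public using (Polynomial; solve; con; _:=_; _:+_; _:*_; _:-_; :-_; _:^_)

  :0 :1 : ∀ {n} → Polynomial n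
  :0 = con (+ 0)
  :1 = con (+ 1)

-- Ordered-field arithmetic and geometric growth.

module OrderedField (em : ExcludedMiddle 0ℓ) (ℝ : CompleteOrderedField) where

  open CompleteOrderedField ℝ hiding (zero)
  open Expansions ℝ
  open IntegerCoefficients ℝ
  open RawSemiringDefinitions (Semiring.rawSemiring semiring) using (_^_)
  open IsTotalOrder isTotalOrder public
    using () renaming
    (refl to ≤-refl; reflexive to ≤-reflexive; trans to ≤-trans; antisym to ≤-antisym; total to ≤-total)

  private variable
    a b c d : Carrier

  diff : a ≤ b → 0# ≤ b - a
  diff {a} a≤b =
    ≤-trans (≤-reflexive (sym (-‿inverseʳ a))) (+-monoˡ-≤ (- a) a≤b)

  -- Most inequalities below are certified in this form: `a` is a combination of quantities of known
  -- sign, and the solver identifies it with the difference of the two sides.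
  ≤-by : 0# ≤ a → a ≈ d - c → c ≤ d
  ≤-by {a} {d} {c} 0≤a a≈d-c = ≤-trans
    (≤-reflexive (sym (+-identityˡ c)))
    (≤-trans (+-monoˡ-≤ c (≤-trans 0≤a (≤-reflexive a≈d-c)))
      (≤-reflexive (solve 2 (λ c d → (d :- c) :+ c := d) refl c d)))

  diff⁺ : a < b → 0# < b - a
  diff⁺ {a} {b} (a≤b , a≉b) = diff a≤b , λ 0≈b-a → a≉b
    (trans (solve 1 (λ a → a := :0 :+ a) refl a)
      (trans (+-congʳ 0≈b-a) (solve 2 (λ a b → b :- a :+ a := b) refl a b)))

  <-by : 0# < a → a ≈ d - c → c < d
  <-by {a} {d} {c} (0≤a , 0≉a) a≈d-c = ≤-by 0≤a a≈d-c , λ c≈d → 0≉a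
    (sym (trans a≈d-c (trans (+-congʳ (sym c≈d)) (-‿inverseʳ c))))

  infixl 6 _+₀_ _+₁_
  infixl 7 _*₀_ _*₁_

  _+₀_ : 0# ≤ a → 0# ≤ b → 0# ≤ a + b
  _+₀_ {a} {b} 0≤a 0≤b = ≤-trans 0≤b
    (≤-trans (≤-reflexive (sym (+-identityˡ b))) (+-monoˡ-≤ b 0≤a))

  _*₀_ : 0# ≤ a → 0# ≤ b → 0# ≤ a * b
  _*₀_ = *-nonNeg

  _+₁_ : 0# < a → 0# ≤ b → 0# < a + b
  _+₁_ {a} {b} (0≤a , 0≉a) 0≤b = 0≤a +₀ 0≤b , λ 0≈a+b → 0≉a (≤-antisym 0≤a
    (≤-by 0≤b (trans (solve 2 (λ a b → b := (a :+ b) :- a) refl a b) (+-congʳ (sym 0≈a+b)))))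

  ≉⇒*-cancelˡ : ¬ a ≈ 0# → a * b ≈ a * c → b ≈ c
  ≉⇒*-cancelˡ {a} {b} {c} a≉0 ab≈ac = trans (undo b)
    (trans (*-congˡ ab≈ac) (sym (undo c)))
    where
    undo : ∀ x → x ≈ a ⁻¹ * (a * x)
    undo x = trans (sym (*-identityˡ x)) (trans (*-congʳ (sym (*-inverseʳ a≉0)))
      (solve 3 (λ a i x → a :* i :* x := i :* (a :* x)) refl a (a ⁻¹) x))

  <⇒≉0 : 0# < a → ¬ a ≈ 0#
  <⇒≉0 (_ , 0≉a) a≈0 = 0≉a (sym a≈0)

  _*₁_ : 0# < a → 0# < b → 0# < a * b
  0<a *₁ 0<b = proj₁ 0<a *₀ proj₁ 0<b , λ 0≈ab → proj₂ 0<b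
    (≉⇒*-cancelˡ (<⇒≉0 0<a) (trans (zeroʳ _) 0≈ab))

  <⇒≱ : a < b → ¬ b ≤ a
  <⇒≱ (a≤b , a≉b) b≤a = a≉b (≤-antisym a≤b b≤a)

  ≤-or-> : ∀ a b → a ≤ b ⊎ b < a
  ≤-or-> a b with em {a ≤ b} | ≤-total a b
  ... | yes a≤b | _        = inj₁ a≤b
  ... | no a≰b  | inj₁ a≤b = ⊥-elim (a≰b a≤b)
  ... | no a≰b  | inj₂ b≤a = inj₂ (b≤a , λ b≈a → a≰b (≤-reflexive (sym b≈a)))

  ≮⇒≥ : ¬ a < b → b ≤ a
  ≮⇒≥ {a} {b} a≮b with ≤-or-> b a
  ... | inj₁ b≤a = b≤a
  ... | inj₂ a<b = ⊥-elim (a≮b a<b)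

  ≰⇒> : ¬ a ≤ b → b < a
  ≰⇒> {a} {b} a≰b with ≤-or-> a b
  ... | inj₁ a≤b = ⊥-elim (a≰b a≤b)
  ... | inj₂ b<a = b<a

  0<1 : 0# < 1#
  0<1 = 0≤1 (≤-total 0# 1#) , 0≉1
    where
    0≤1 : 0# ≤ 1# ⊎ 1# ≤ 0# → 0# ≤ 1#
    0≤1 (inj₁ p) = p
    0≤1 (inj₂ 1≤0) = ≤-by (diff 1≤0 *₀ diff 1≤0)
      (solve 0 ((:0 :- :1) :* (:0 :- :1) := :1 :- :0) refl)

  *-cancelˡ-≤ : 0# < c → c * a ≤ c * b → a ≤ b
  *-cancelˡ-≤ {c} {a} {b} 0<c ca≤cb = ≮⇒≥ λ b<a → <⇒≱
    (<-by (0<c *₁ diff⁺ b<a) (solve 3 (λ a b c → c :* (a :- b) := c :* a :- c :* b) refl a b c))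
    ca≤cb

  *-cancelˡ-< : 0# < c → c * a < c * b → a < b
  *-cancelˡ-< {c} {a} {b} 0<c ca<cb = ≰⇒> λ b≤a → <⇒≱ ca<cb
    (≤-by (proj₁ 0<c *₀ diff b≤a) (solve 3 (λ a b c → c :* (a :- b) := c :* a :- c :* b) refl a b c))

  0<⁻¹ : 0# < a → 0# < a ⁻¹
  0<⁻¹ {a} 0<a = *-cancelˡ-< 0<a (<-by 0<1
    (trans (sym (*-inverseʳ (<⇒≉0 0<a)))
      (solve 2 (λ a i → a :* i := a :* i :- a :* :0) refl a (a ⁻¹))))

  ≤-cong : a ≈ b → c ≈ d → a ≤ c → b ≤ d
  ≤-cong a≈b c≈d a≤c = ≤-trans (≤-reflexive (sym a≈b)) (≤-trans a≤c (≤-reflexive c≈d))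

  <-cong : a ≈ b → c ≈ d → a < c → b < d
  <-cong a≈b c≈d (a≤c , a≉c) =
    ≤-cong a≈b c≈d a≤c , λ b≈d → a≉c (trans a≈b (trans b≈d (sym c≈d)))

  module Growth (q : Carrier) (1<q : 1# < q) where

    0<q : 0# < q
    0<q = <-by (diff⁺ 1<q +₁ proj₁ 0<1) (solve 1 (λ q → (q :- :1) :+ :1 := q :- :0) refl q)

    1≤q^ : ∀ n → 1# ≤ q ^ n
    1≤q^ zero    = ≤-refl
    1≤q^ (suc n) = ≤-by
      (proj₁ 0<q *₀ diff (1≤q^ n) +₀ proj₁ (diff⁺ 1<q))
      (solve 2 (λ q x → q :* (x :- :1) :+ (q :- :1) := q :* x :- :1) refl q (q ^ n))

    0<q^ : ∀ n → 0# < q ^ n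
    0<q^ n = <-by (0<1 +₁ diff (1≤q^ n)) (solve 1 (λ x → :1 :+ (x :- :1) := x :- :0) refl (q ^ n))

    -- Otherwise sup qⁿy / q would again bound the qⁿy.
    unbounded : ∀ {y} → 0# < y → ∀ b → ∃ λ n → b ≤ q ^ n * y
    unbounded {y} 0<y b with em {∃ λ n → b ≤ q ^ n * y}
    ... | yes found = found
    ... | no none = ⊥-elim (<⇒≱ s/q<s (least s/q-bounds))
      where
      P : Carrier → Set
      P z = ∃ λ n → z ≈ q ^ n * y

      sup : ∃ λ s → UpperBound P s × (∀ {c} → UpperBound P c → s ≤ c)
      sup = supremum P (1# * y , 0 , refl)
        (b , λ (n , z≈) → ≤-trans (≤-reflexive z≈) (proj₁ (≰⇒> λ b≤ → none (n , b≤))))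

      s r : Carrier
      s = proj₁ sup
      r = q ⁻¹

      bounds : UpperBound P s
      bounds = proj₁ (proj₂ sup)

      least : ∀ {c} → UpperBound P c → s ≤ c
      least = proj₂ (proj₂ sup)

      qr≈1 : q * r ≈ 1#
      qr≈1 = *-inverseʳ (<⇒≉0 0<q)

      q[rs]≈s : q * (r * s) ≈ s
      q[rs]≈s = trans (sym (*-assoc q r s)) (trans (*-congʳ qr≈1) (*-identityˡ s))

      s/q-bounds : UpperBound P (r * s)
      s/q-bounds (n , z≈) = ≤-trans (≤-reflexive z≈) (*-cancelˡ-≤ 0<q
        (≤-trans (bounds (suc n , sym (*-assoc q (q ^ n) y))) (≤-reflexive (sym q[rs]≈s))))

      0<s : 0# < s
      0<s = <-by (0<y +₁ diff (bounds (0 , sym (*-identityˡ y))))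
        (solve 2 (λ s y → y :+ (s :- y) := s :- :0) refl s y)

      s/q<s : r * s < s
      s/q<s = *-cancelˡ-< 0<q (<-by (diff⁺ 1<q *₁ 0<s)
        (trans (solve 2 (λ q s → (q :- :1) :* s := q :* s :- s) refl q s)
          (+-congˡ (-‿cong (sym q[rs]≈s)))))

    q^-mono : ∀ {m n y} → 0# ≤ y → m ℕ.≤ n → q ^ m * y ≤ q ^ n * y
    q^-mono {n = n} {y} 0≤y ℕ.z≤n = ≤-by (diff (1≤q^ n) *₀ 0≤y)
      (solve 2 (λ x y → (x :- :1) :* y := x :* y :- :1 :* y) refl (q ^ n) y)
    q^-mono {suc m} {suc n} {y} 0≤y (ℕ.s≤s m≤n) = ≤-by (proj₁ 0<q *₀ diff (q^-mono 0≤y m≤n))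
      (solve 4 (λ q v w y → q :* (w :* y :- v :* y) := q :* w :* y :- q :* v :* y)
        refl q (q ^ m) (q ^ n) y)

    -- Induction along an orbit on which m is multiplied by q until it reaches b.
    escape : (m : Carrier → Carrier) (I G : Carrier → Set) (b : Carrier) →
      (∀ {X} → I X → b ≤ m X → G X) →
      (∀ {X} → I X → m X < b → ∃ λ Y → I Y × q * m X ≈ m Y × (G Y → G X)) →
      ∀ {X} → I X → 0# < m X → G X
    escape m I G b stop move {X} IX 0<mX = go (proj₁ bound) IX (proj₂ bound)
      where
      bound : ∃ λ n → b ≤ q ^ n * m X
      bound = unbounded 0<mX b

      go : ∀ n {X} → I X → b ≤ q ^ n * m X → G X
      go zero IX b≤ = stop IX (≤-trans b≤ (≤-reflexive (*-identityˡ _)))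
      go (suc n) {X} IX b≤ with ≤-or-> b (m X)
      ... | inj₁ b≤mX = stop IX b≤mX
      ... | inj₂ mX<b with move IX mX<b
      ...   | Y , IY , qmX≈mY , back = back (go n IY (≤-trans b≤ (≤-reflexive
        (trans (solve 3 (λ q w x → q :* w :* x := w :* (q :* x)) refl q (q ^ n) (m X))
          (*-congˡ qmX≈mY)))))

-- Cantor-Bernstein for setoids.

module CantorBernstein (em : ExcludedMiddle 0ℓ) {S T : Setoid 0ℓ 0ℓ}
  (F : Injection S T) (G : Injection T S) where

  private
    module S = Setoid S
    module T = Setoid T
    module F = Injection F
    module G = Injection G

  -- The points reached by iterating `G ∘ F` from outside the image of `G`. There the bijection has
  -- to be `F`, since `G` cannot be inverted at the start; everywhere else it is the inverse of `G`.
  data Chain (a : S.Carrier) : Set where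
    start : ¬ (∃ λ b → G.to b S.≈ a) → Chain a
    next  : ∀ {a′} → Chain a′ → G.to (F.to a′) S.≈ a → Chain a

  chain-resp : ∀ {a a′} → a S.≈ a′ → Chain a → Chain a′
  chain-resp a≈a′ (start none)  = start λ (b , gb≈a′) → none (b , S.trans gb≈a′ (S.sym a≈a′))
  chain-resp a≈a′ (next c gf≈a) = next c (S.trans gf≈a a≈a′)

  preimage : ∀ {a} → ¬ Chain a → ∃ λ b → G.to b S.≈ a
  preimage {a} ¬c with em {∃ λ b → G.to b S.≈ a}
  ... | yes found = found
  ... | no none   = ⊥-elim (¬c (start none))

  to : S.Carrier → T.Carrier
  to a with em {Chain a}
  ... | yes _ = F.to a
  ... | no ¬c = proj₁ (preimage ¬c)

  to-chain : ∀ {a} → Chain a → to a T.≈ F.to a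
  to-chain {a} c with em {Chain a}
  ... | yes _ = T.refl
  ... | no ¬c = ⊥-elim (¬c c)

  to-¬chain : ∀ {a} → ¬ Chain a → G.to (to a) S.≈ a
  to-¬chain {a} ¬c with em {Chain a}
  ... | yes c  = ⊥-elim (¬c c)
  ... | no ¬c′ = proj₂ (preimage ¬c′)

  to-cong : ∀ {a a′} → a S.≈ a′ → to a T.≈ to a′
  to-cong {a} {a′} a≈a′ with em {Chain a}
  ... | yes c = T.trans (F.cong a≈a′) (T.sym (to-chain (chain-resp a≈a′ c)))
  ... | no ¬c = G.injective (S.trans (proj₂ (preimage ¬c)) (S.trans a≈a′
    (S.sym (to-¬chain λ c → ¬c (chain-resp (S.sym a≈a′) c)))))

  separated : ∀ {a a′} → Chain a → ¬ Chain a′ → ¬ to a T.≈ to a′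
  separated c ¬c′ eq = ¬c′ (next c
    (S.trans (G.cong (T.trans (T.sym (to-chain c)) eq)) (to-¬chain ¬c′)))

  to-injective : ∀ {a a′} → to a T.≈ to a′ → a S.≈ a′
  to-injective {a} {a′} eq = by-cases em em
    where
    by-cases : Dec (Chain a) → Dec (Chain a′) → a S.≈ a′
    by-cases (yes c) (yes c′) =
      F.injective (T.trans (T.sym (to-chain c)) (T.trans eq (to-chain c′)))
    by-cases (yes c) (no ¬c′) = ⊥-elim (separated c ¬c′ eq)
    by-cases (no ¬c) (yes c′) = ⊥-elim (separated c′ ¬c (T.sym eq))
    by-cases (no ¬c) (no ¬c′) =
      S.trans (S.sym (to-¬chain ¬c)) (S.trans (G.cong eq) (to-¬chain ¬c′))

  to-surjective : ∀ b → ∃ λ a → to a T.≈ b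
  to-surjective b with em {Chain (G.to b)}
  ... | no ¬c                     = G.to b , G.injective (to-¬chain ¬c)
  ... | yes (start none)          = ⊥-elim (none (b , S.refl))
  ... | yes (next {a} c gfa≈gb)   = a , T.trans (to-chain c) (G.injective gfa≈gb)

  bijection : Bijection S T
  bijection = record
    { to        = to
    ; cong      = to-cong
    ; bijective = to-injective , λ b →
        let a , fa≈b = to-surjective b
        in a , λ z≈a → T.trans (to-cong z≈a) fa≈b
    }

-- Expansions as bounded orbits.

data Digit : Set where
  zero one base : Digit

Code : Set
Code = ℕ → Digit

module Base (em : ExcludedMiddle 0ℓ) (ℝ : CompleteOrderedField)
  (q : CompleteOrderedField.Carrier ℝ)
  (1<q : Expansions._<_ ℝ (CompleteOrderedField.1# ℝ) q) where

  open CompleteOrderedField ℝ hiding (zero)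
  open Expansions ℝ
  open IntegerCoefficients ℝ
  open OrderedField em ℝ
  open Growth q 1<q
  open RingProperties ring using (-‿distribʳ-*; -‿involutive)
  open RawSemiringDefinitions (Semiring.rawSemiring semiring) using (_^_; sum)
  open SemiringSum semiring using (*-distribˡ-sum; sum-cong-≋)

  p r : Carrier
  p = q - 1#
  r = q ⁻¹

  0<p : 0# < p
  0<p = diff⁺ 1<q

  qr≈1 : q * r ≈ 1#
  qr≈1 = *-inverseʳ (<⇒≉0 0<q)

  0<r : 0# < r
  0<r = 0<⁻¹ 0<q

  value : Digit → Carrier
  value zero = 0#
  value one  = 1#
  value base = q

  0≤value : ∀ d → 0# ≤ value d
  0≤value zero = ≤-refl
  0≤value one  = proj₁ 0<1
  0≤value base = proj₁ 0<q

  value≤q : ∀ d → value d ≤ q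
  value≤q zero = proj₁ 0<q
  value≤q one  = proj₁ 1<q
  value≤q base = ≤-refl

  value-injective : ∀ d e → value d ≈ value e → d ≡ e
  value-injective zero zero _  = ≡.refl
  value-injective zero one  eq = ⊥-elim (0≉1 eq)
  value-injective zero base eq = ⊥-elim (proj₂ 0<q eq)
  value-injective one  zero eq = ⊥-elim (0≉1 (sym eq))
  value-injective one  one  _  = ≡.refl
  value-injective one  base eq = ⊥-elim (proj₂ 1<q eq)
  value-injective base zero eq = ⊥-elim (proj₂ 0<q (sym eq))
  value-injective base one  eq = ⊥-elim (proj₂ 1<q (sym eq))
  value-injective base base _  = ≡.refl

  -- A point x is rescaled to X = (q - 1) x, so that the interval [0, q / (q - 1)]
  -- spanned by all expansions becomes [0, q] and no divisions occur.
  step : Digit → Carrier → Carrier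
  step d X = q * X - p * value d

  step-cong : ∀ d {X Y} → X ≈ Y → step d X ≈ step d Y
  step-cong d X≈Y = +-congʳ (*-congˡ X≈Y)

  orbit : Carrier → Code → ℕ → Carrier
  orbit X c zero    = X
  orbit X c (suc n) = orbit (step (c 0) X) (c ∘ suc) n

  orbit-cong : ∀ {X Y c e} → X ≈ Y → c ≗ e → ∀ n → orbit X c n ≈ orbit Y e n
  orbit-cong X≈Y c≗e zero = X≈Y
  orbit-cong {X} {Y} {c} {e} X≈Y c≗e (suc n) = orbit-cong
    (trans (step-cong (c 0) X≈Y) (reflexive (≡.cong (λ d → step d Y) (c≗e 0))))
    (c≗e ∘ suc) n

  InRange : Carrier → Set
  InRange X = 0# ≤ X × X ≤ q

  inRange-resp : ∀ {X Y} → X ≈ Y → InRange X → InRange Y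
  inRange-resp X≈Y (0≤X , X≤q) = ≤-cong refl X≈Y 0≤X , ≤-cong X≈Y refl X≤q

  Valid : Carrier → Code → Set
  Valid X c = ∀ n → InRange (orbit X c n)

  valid-resp : ∀ {X Y c e} → X ≈ Y → c ≗ e → Valid X c → Valid Y e
  valid-resp X≈Y c≗e valid n = inRange-resp (orbit-cong X≈Y c≗e n) (valid n)

  codeSetoid : Carrier → Setoid 0ℓ 0ℓ
  codeSetoid X = On.setoid {B = Σ Code (Valid X)} (ℕ →-setoid Digit) proj₁

  -- Digit 0 gives the largest orbit, and it multiplies `X` by `q`. A negative point therefore runs
  -- off at the full rate `q ^ n`.
  orbit-lower : ∀ X c n → orbit X c n ≤ q ^ n * X
  orbit-lower X c zero    = ≤-reflexive (sym (*-identityˡ X))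
  orbit-lower X c (suc n) = ≤-trans (orbit-lower (step (c 0) X) (c ∘ suc) n) (≤-by
    (proj₁ (0<q^ n) *₀ (proj₁ 0<p *₀ 0≤value (c 0)))
    (solve 4 (λ q w X v → w :* ((q :- :1) :* v) := q :* w :* X :- w :* (q :* X :- (q :- :1) :* v))
      refl q (q ^ n) X (value (c 0))))

  -- Digit q gives the smallest orbit, and it multiplies the distance to `q` by `q`; this drives
  -- points above `q` away.
  orbit-upper : ∀ X c n → q ^ n * (X - q) ≤ orbit X c n - q
  orbit-upper X c zero    = ≤-reflexive (*-identityˡ _)
  orbit-upper X c (suc n) = ≤-trans (≤-by
    (proj₁ (0<q^ n) *₀ (proj₁ 0<p *₀ diff (value≤q (c 0))))
    (solve 4 (λ q w X v → w :* ((q :- :1) :* (q :- v)) :=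
      w :* (q :* X :- (q :- :1) :* v :- q) :- q :* w :* (X :- q))
      refl q (q ^ n) X (value (c 0))))
    (orbit-upper (step (c 0) X) (c ∘ suc) n)

  r^q^≈1 : ∀ n → r ^ n * q ^ n ≈ 1#
  r^q^≈1 zero    = *-identityˡ 1#
  r^q^≈1 (suc n) = trans
    (solve 4 (λ q r w v → r :* v :* (q :* w) := (q :* r) :* (v :* w)) refl q r (q ^ n) (r ^ n))
    (trans (*-cong qr≈1 (r^q^≈1 n)) (*-identityˡ 1#))

  0<r^ : ∀ n → 0# < r ^ n
  0<r^ zero    = 0<1
  0<r^ (suc n) = 0<r *₁ 0<r^ n

  r^q^* : ∀ n x → r ^ n * (q ^ n * x) ≈ x
  r^q^* n x = trans (sym (*-assoc _ _ x)) (trans (*-congʳ (r^q^≈1 n)) (*-identityˡ x))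

  inverse-q^ : ∀ n → (q ^ n) ⁻¹ ≈ r ^ n
  inverse-q^ n = ≉⇒*-cancelˡ (<⇒≉0 (0<q^ n))
    (trans (*-inverseʳ (<⇒≉0 (0<q^ n))) (trans (sym (r^q^≈1 n)) (*-comm _ _)))

  -- Convergence of the series, expressed through the orbit: by `residual` the rescaled remainder
  -- after `n` digits is `r ^ n * orbit X c n`.
  Vanishing : Carrier → Code → Set
  Vanishing X c = ∀ ε → 0# < ε → ∃ λ N → ∀ n → N ℕ.≤ n →
    (- ε < r ^ n * orbit X c n) × (r ^ n * orbit X c n < ε)

  vanishing-step : ∀ {X c} → Vanishing X c → Vanishing (step (c 0) X) (c ∘ suc)
  vanishing-step {X} {c} vanish ε 0<ε =
    let N , close = vanish (r * ε) (0<r *₁ 0<ε) in N , λ n N≤n →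
    let lower , upper = close (suc n) (ℕ.m≤n⇒m≤1+n N≤n) in
    *-cancelˡ-< 0<r (<-cong (-‿distribʳ-* r ε) (*-assoc _ _ _) lower) ,
    *-cancelˡ-< 0<r (<-cong (*-assoc _ _ _) refl upper)

  -- Outside [0, q] the orbit recedes so fast that the factor `r ^ n` does not compensate: the
  -- remainder stays at most `X` if `X` is negative, and at least `X - q` if `X` exceeds `q`.
  vanishing⇒inRange : ∀ {X c} → Vanishing X c → InRange X
  vanishing⇒inRange {X} {c} vanish = ≮⇒≥ X≮0 , ≮⇒≥ q≮X
    where
    X≮0 : ¬ X < 0#
    X≮0 X<0 = let N , close = vanish (- X) (<-cong refl (+-identityˡ _) (diff⁺ X<0))
      in <⇒≱ (proj₁ (close N ℕ.≤-refl)) (≤-cong refl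
        (trans (r^q^* N X) (solve 1 (λ X → X := :- :- X) refl X))
        (≤-by (proj₁ (0<r^ N) *₀ diff (orbit-lower X c N))
          (solve 3 (λ v a b → v :* (b :- a) := v :* b :- v :* a) refl _ _ _)))

    q≮X : ¬ q < X
    q≮X q<X = let N , close = vanish (X - q) (diff⁺ q<X)
      in <⇒≱ (proj₂ (close N ℕ.≤-refl)) (≤-cong (r^q^* N (X - q)) refl
        (≤-by (proj₁ (0<r^ N) *₀ diff (orbit-upper X c N) +₀ (proj₁ (0<r^ N) *₀ proj₁ 0<q))
          (solve 4 (λ v a b q → v :* (b :- q :- a) :+ v :* q := v :* b :- v :* a) refl _ _ _ q)))

  vanishing⇒valid : ∀ {X c} → Vanishing X c → Valid X c
  vanishing⇒valid vanish zero    = vanishing⇒inRange vanish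
  vanishing⇒valid vanish (suc n) = vanishing⇒valid (vanishing-step vanish) n

  expansionSum : (ℕ → Carrier) → ℕ → Carrier
  expansionSum d n = sum {n} (λ i → d (toℕ i) / q ^ suc (toℕ i))

  expansionSum-suc : ∀ d n → expansionSum d (suc n) ≈ r * (d 0 + expansionSum (d ∘ suc) n)
  expansionSum-suc d n = begin
    d 0 * (q ^ 1) ⁻¹ + sum {n} (λ i → d (suc (toℕ i)) / q ^ suc (suc (toℕ i)))
      ≈⟨ +-cong (trans (*-congˡ (inverse-q^ 1))
           (solve 2 (λ d r → d :* (r :* :1) := r :* d) refl (d 0) r))
           (sum-cong-≋ {n} λ i → shift (toℕ i)) ⟩
    r * d 0 + sum {n} (λ i → r * (d (suc (toℕ i)) / q ^ suc (toℕ i)))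
      ≈⟨ +-congˡ (*-distribˡ-sum {n} r _) ⟨
    r * d 0 + r * expansionSum (d ∘ suc) n
      ≈⟨ distribˡ r _ _ ⟨
    r * (d 0 + expansionSum (d ∘ suc) n) ∎
    where
    open import Relation.Binary.Reasoning.Setoid setoid
    shift : ∀ i → d (suc i) / q ^ suc (suc i) ≈ r * (d (suc i) / q ^ suc i)
    shift i = trans (*-congˡ (inverse-q^ (suc (suc i)))) (trans
      (solve 3 (λ d r v → d :* (r :* v) := r :* (d :* v)) refl (d (suc i)) r (r ^ suc i))
      (*-congˡ (*-congˡ (sym (inverse-q^ (suc i))))))

  -- Splitting off the first digit of the partial sum amounts to one `step`, up to a factor `r`.
  residual : ∀ {d c} → (∀ i → d i ≈ value (c i)) → ∀ X n →
    X - p * expansionSum d n ≈ r ^ n * orbit X c n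
  residual d≈c X zero = solve 2 (λ q X → X :- (q :- :1) :* :0 := :1 :* X) refl q X
  residual {d} {c} d≈c X (suc n) = begin
    X - p * expansionSum d (suc n)
      ≈⟨ +-congˡ (-‿cong (*-congˡ (trans (expansionSum-suc d n) (*-congˡ (+-congʳ (d≈c 0)))))) ⟩
    X - p * (r * (value (c 0) + S))
      ≈⟨ +-congʳ (trans (sym (*-identityˡ X)) (*-congʳ (sym qr≈1))) ⟩
    q * r * X - p * (r * (value (c 0) + S))
      ≈⟨ solve 5 (λ q r X v S → q :* r :* X :- (q :- :1) :* (r :* (v :+ S)) :=
           r :* (q :* X :- (q :- :1) :* v :- (q :- :1) :* S)) refl q r X (value (c 0)) S ⟩
    r * (step (c 0) X - p * S)
      ≈⟨ *-congˡ (residual (d≈c ∘ suc) (step (c 0) X) n) ⟩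
    r * (r ^ n * orbit (step (c 0) X) (c ∘ suc) n)
      ≈⟨ *-assoc r _ _ ⟨
    r * r ^ n * orbit (step (c 0) X) (c ∘ suc) n ∎
    where
    open import Relation.Binary.Reasoning.Setoid setoid
    S : Carrier
    S = expansionSum (d ∘ suc) n

  scaled-error : ∀ {d c x X} → (∀ i → d i ≈ value (c i)) → X ≈ p * x → ∀ n →
    p * (expansionSum d n - x) ≈ - (r ^ n * orbit X c n)
  scaled-error {d} {c} {x} {X} d≈c X≈px n = begin
    p * (S - x)              ≈⟨ solve 3 (λ p S x → p :* (S :- x) := :- (p :* x :- p :* S)) refl p S x ⟩
    - (p * x - p * S)        ≈⟨ -‿cong (+-congʳ X≈px) ⟨
    - (X - p * S)            ≈⟨ -‿cong (residual d≈c X n) ⟩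
    - (r ^ n * orbit X c n)  ∎
    where
    open import Relation.Binary.Reasoning.Setoid setoid
    S : Carrier
    S = expansionSum d n

  scale-bounds : ∀ {e s t} → p * s ≈ - t → - e < s → s < e → (- (p * e) < t) × (t < p * e)
  scale-bounds {e} {s} {t} ps≈-t lower upper =
    <-by (0<p *₁ diff⁺ upper) (trans
      (solve 3 (λ p e s → p :* (e :- s) := (:- (p :* s)) :- (:- (p :* e))) refl p e s)
      (+-congʳ (trans (-‿cong ps≈-t) (-‿involutive t)))) ,
    <-by (0<p *₁ diff⁺ lower) (trans
      (solve 3 (λ p e s → p :* (s :- (:- e)) := p :* e :+ p :* s) refl p e s)
      (+-congˡ ps≈-t))

  hasSum⇒vanishing : ∀ {d : ℕ → Carrier} {c x X} → (∀ i → d i ≈ value (c i)) → X ≈ p * x →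
    (λ i → d i / q ^ suc i) HasSum x → Vanishing X c
  hasSum⇒vanishing {d} {c} {x} {X} d≈c X≈px hasSum ε 0<ε =
    let N , close = hasSum (p ⁻¹ * ε) (0<⁻¹ 0<p *₁ 0<ε) in N , λ n N≤n →
    let lower , upper = close n N≤n
        lower′ , upper′ = scale-bounds (scaled-error {d} d≈c X≈px n) lower upper
    in <-cong (-‿cong p[p⁻¹ε]≈ε) refl lower′ , <-cong refl p[p⁻¹ε]≈ε upper′
    where
    p[p⁻¹ε]≈ε : p * (p ⁻¹ * ε) ≈ ε
    p[p⁻¹ε]≈ε = trans (sym (*-assoc p _ ε)) (trans (*-congʳ (*-inverseʳ (<⇒≉0 0<p))) (*-identityˡ ε))

  valid⇒hasSum : ∀ {d : ℕ → Carrier} {c x X} → (∀ i → d i ≈ value (c i)) → X ≈ p * x →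
    Valid X c → (λ i → d i / q ^ suc i) HasSum x
  valid⇒hasSum {d} {c} {x} {X} d≈c X≈px valid ε 0<ε = N , λ n N≤n →
    let S = expansionSum d n
        t = r ^ n * orbit X c n
        err = scaled-error d≈c X≈px n
        q+1≤q^npε = ≤-trans large (q^-mono (proj₁ (0<p *₁ 0<ε)) N≤n)
        t<pε : t < p * ε
        t<pε = <-cong refl (r^q^* n (p * ε)) (<-by
          (0<r^ n *₁ (<-by (0<1 +₁ (diff q+1≤q^npε +₀ diff (proj₂ (valid n))))
            (solve 3 (λ q a b → :1 :+ (b :- (q :+ :1) :+ (q :- a)) := (b :- a) :- :0) refl q _ _)))
          (solve 3 (λ v a b → v :* (b :- a) := v :* b :- v :* a) refl _ _ _))
    in *-cancelˡ-< 0<p (<-by (diff⁺ t<pε) (trans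
         (solve 3 (λ p e t → p :* e :- t := (:- t) :- p :* (:- e)) refl p ε t)
         (+-congʳ (sym err)))) ,
       *-cancelˡ-< 0<p (<-by
         ((0<p *₁ 0<ε) +₁ (proj₁ (0<r^ n) *₀ proj₁ (valid n)))
         (trans (solve 3 (λ p e t → p :* e :+ t := p :* e :- (:- t)) refl p ε t)
           (+-congˡ (-‿cong (sym err)))))
    where
    bound : ∃ λ N → q + 1# ≤ q ^ N * (p * ε)
    -- The bound is `q + 1#` and not `q`, so that an orbit with values at most `q` yields a strict
    -- inequality.
    bound = unbounded (0<p *₁ 0<ε) (q + 1#)
    N : ℕ
    N = proj₁ bound
    large : q + 1# ≤ q ^ N * (p * ε)
    large = proj₂ bound

  digit : ∀ {x} → x ≈ 0# ⊎ x ≈ 1# ⊎ x ≈ q → Digit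
  digit (inj₁ _)        = zero
  digit (inj₂ (inj₁ _)) = one
  digit (inj₂ (inj₂ _)) = base

  value-digit : ∀ {x} (v : x ≈ 0# ⊎ x ≈ 1# ⊎ x ≈ q) → x ≈ value (digit v)
  value-digit (inj₁ x≈0)        = x≈0
  value-digit (inj₂ (inj₁ x≈1)) = x≈1
  value-digit (inj₂ (inj₂ x≈q)) = x≈q

  value-isDigit : ∀ d → value d ≈ 0# ⊎ value d ≈ 1# ⊎ value d ≈ q
  value-isDigit zero = inj₁ refl
  value-isDigit one  = inj₂ (inj₁ refl)
  value-isDigit base = inj₂ (inj₂ refl)

  -- Since 0, 1 and q are distinct, a field element names at most one `Digit`, whichever disjunct of
  -- `IsExpansion` is supplied.
  expansions↔codes : ∀ {x X} → X ≈ p * x → Bijection (expansionSetoid q x) (codeSetoid X)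
  expansions↔codes X≈px = record
    { to = λ (d , digits , hasSum) → (λ i → digit (digits i)) ,
        vanishing⇒valid (hasSum⇒vanishing {d = d} (λ i → value-digit (digits i)) X≈px hasSum)
    ; cong = λ { {d , ds , _} {e , es , _} d≈e i → value-injective _ _
        (trans (sym (value-digit (ds i))) (trans (d≈e i) (value-digit (es i)))) }
    ; bijective =
        (λ { {d , ds , _} {e , es , _} eq i → trans (value-digit (ds i))
          (trans (reflexive (≡.cong value (eq i))) (sym (value-digit (es i)))) }) ,
        λ (c , valid) →
          (value ∘ c , value-isDigit ∘ c , valid⇒hasSum (λ _ → refl) X≈px valid) ,
          λ { {z , zs , _} z≈ i → value-injective _ _ (trans (sym (value-digit (zs i))) (z≈ i)) }
    }

  codes⇒𝓑 : ∀ κ {X} → ∃ (Valid X) → HasCardinality (codeSetoid X) κ → 𝓑 κ q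
  codes⇒𝓑 κ {X} (c , valid) card =
    1<q , x , (value ∘ c , value-isDigit ∘ c , valid⇒hasSum (λ _ → refl) X≈px valid) ,
    Composition.bijection (expansions↔codes X≈px) card
    where
    x : Carrier
    x = p ⁻¹ * X
    X≈px : X ≈ p * x
    X≈px = sym (trans (sym (*-assoc p _ X))
      (trans (*-congʳ (*-inverseʳ (<⇒≉0 0<p))) (*-identityˡ X)))

  𝓑⇒codes : ∀ κ → 𝓑 κ q → ∃ λ X → ∃ (Valid X) × HasCardinality (codeSetoid X) κ
  𝓑⇒codes κ (_ , x , expansion , card) = p * x , Bijection.to ex↔codes expansion ,
    Composition.bijection
      (Inverse⇒Bijection (Symmetry.inverse (Bijection⇒Inverse ex↔codes))) card
    where
    ex↔codes : Bijection (expansionSetoid q x) (codeSetoid (p * x))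
    ex↔codes = expansions↔codes refl

  -- Prefixes, forced digits and unique codes.

  cons : Digit → Code → Code
  cons d c zero    = d
  cons d c (suc n) = c n

  valid-cons : ∀ {X d c} → InRange X → Valid (step d X) c → Valid X (cons d c)
  valid-cons inX valid zero    = inX
  valid-cons inX valid (suc n) = valid n

  valid-tail : ∀ {X d c} → c 0 ≡ d → Valid X c → Valid (step d X) (c ∘ suc)
  valid-tail ≡.refl valid n = valid (suc n)

  Forced : Digit → Carrier → Set
  Forced d X = ∀ e → InRange (step e X) → e ≡ d

  Unique : Carrier → Code → Set
  Unique X c = Valid X c × (∀ {e} → Valid X e → e ≗ c)

  unique-resp : ∀ {X Y c} → X ≈ Y → Unique X c → Unique Y c
  unique-resp X≈Y (valid , only) =
    valid-resp X≈Y (λ _ → ≡.refl) valid , λ v → only (valid-resp (sym X≈Y) (λ _ → ≡.refl) v)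

  unique-cons : ∀ {X d c} → InRange X → Forced d X → Unique (step d X) c → Unique X (cons d c)
  unique-cons {X} {d} {c} inX forced (valid , only) = valid-cons inX valid , agree
    where
    agree : ∀ {e} → Valid X e → e ≗ cons d c
    agree {e} v zero    = forced (e 0) (v 1)
    agree {e} v (suc n) = only (valid-tail (forced (e 0) (v 1)) v) n

  -- Codes generated by a state machine. The states are later the interior points, each moved by a
  -- chosen digit, and the indices along the cycle of (1ᵐq)^∞.
  module Run {S : Set} (digitAt : S → Digit) (next : S → S) (point : S → Carrier)
    (inRange : ∀ s → InRange (point s))
    (moves : ∀ s → step (digitAt s) (point s) ≈ point (next s)) where

    run : S → Code
    run s zero    = digitAt s
    run s (suc n) = run (next s) n

    run-valid : ∀ s → Valid (point s) (run s)
    run-valid s zero    = inRange s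
    run-valid s (suc n) = inRange-resp (orbit-cong (sym (moves s)) (λ _ → ≡.refl) n) (run-valid (next s) n)

    run-unique : (∀ s → Forced (digitAt s) (point s)) → ∀ s → Unique (point s) (run s)
    run-unique forced s = run-valid s , λ v → agree s v
      where
      agree : ∀ s {e} → Valid (point s) e → e ≗ run s
      agree s {e} v zero    = forced s (e 0) (v 1)
      agree s {e} v (suc n) = agree (next s) (valid-resp (moves s) (λ _ → ≡.refl)
        (valid-tail (forced s (e 0) (v 1)) v)) n

  zeros ones bases : Code
  zeros _ = zero
  ones  _ = one
  bases _ = base

  too-low : ∀ {X} → X < 0# → ¬ InRange X
  too-low X<0 (0≤X , _) = <⇒≱ X<0 0≤X

  too-high : ∀ {X} → q < X → ¬ InRange X
  too-high q<X (_ , X≤q) = <⇒≱ q<X X≤q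

  forced-zero : ∀ {X} → ¬ InRange (step one X) → ¬ InRange (step base X) → Forced zero X
  forced-zero no₁ no₂ zero _ = ≡.refl
  forced-zero no₁ no₂ one  v = ⊥-elim (no₁ v)
  forced-zero no₁ no₂ base v = ⊥-elim (no₂ v)

  forced-one : ∀ {X} → ¬ InRange (step zero X) → ¬ InRange (step base X) → Forced one X
  forced-one no₁ no₂ zero v = ⊥-elim (no₁ v)
  forced-one no₁ no₂ one  _ = ≡.refl
  forced-one no₁ no₂ base v = ⊥-elim (no₂ v)

  forced-base : ∀ {X} → ¬ InRange (step zero X) → ¬ InRange (step one X) → Forced base X
  forced-base no₁ no₂ zero v = ⊥-elim (no₁ v)
  forced-base no₁ no₂ one  v = ⊥-elim (no₂ v)
  forced-base no₁ no₂ base _ = ≡.refl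

  fixed-valid : ∀ {X d} → InRange X → step d X ≈ X → Valid X (λ _ → d)
  fixed-valid inX fixed zero    = inX
  fixed-valid inX fixed (suc n) =
    inRange-resp (orbit-cong (sym fixed) (λ _ → ≡.refl) n) (fixed-valid inX fixed n)

  fixed-unique : ∀ {X d} → InRange X → step d X ≈ X → Forced d X → Unique X (λ _ → d)
  fixed-unique {X} {d} inX fixed forced = fixed-valid inX fixed , agree
    where
    agree : ∀ {e} → Valid X e → ∀ n → e n ≡ d
    agree {e} v zero    = forced (e 0) (v 1)
    agree {e} v (suc n) = agree
      (valid-resp fixed (λ _ → ≡.refl) (valid-tail (forced (e 0) (v 1)) v)) n

  unique-0 : Unique 0# zeros
  unique-0 = fixed-unique (≤-refl , proj₁ 0<q)
    (solve 1 (λ q → q :* :0 :- (q :- :1) :* :0 := :0) refl q)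
    (forced-zero
      (too-low (<-by 0<p (solve 1 (λ q → q :- :1 := :0 :- (q :* :0 :- (q :- :1) :* :1)) refl q)))
      (too-low (<-by (0<p *₁ 0<q)
        (solve 1 (λ q → (q :- :1) :* q := :0 :- (q :* :0 :- (q :- :1) :* q)) refl q))))

  unique-q : Unique q bases
  unique-q = fixed-unique (proj₁ 0<q , ≤-refl)
    (solve 1 (λ q → q :* q :- (q :- :1) :* q := q) refl q)
    (forced-base
      (too-high (<-by (0<q *₁ 0<p)
        (solve 1 (λ q → q :* (q :- :1) := (q :* q :- (q :- :1) :* :0) :- q) refl q)))
      (too-high (<-by (0<p *₁ 0<p)
        (solve 1 (λ q → (q :- :1) :* (q :- :1) := (q :* q :- (q :- :1) :* :1) :- q) refl q))))

  -- Counting the codes of a point.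

  -- A list rather than a bijection, because it can be extended by one code at a time.
  record Enumeration (X : Carrier) (k : ℕ) : Set where
    field
      code      : Fin k → Code
      valid     : ∀ i → Valid X (code i)
      injective : ∀ i j → code i ≗ code j → i ≡ j
      complete  : ∀ {c} → Valid X c → ∃ λ i → c ≗ code i

  enumeration⇒cardinality : ∀ {X k} → Enumeration X k → HasCardinality (codeSetoid X) (finite k)
  enumeration⇒cardinality enum = record
    { to        = λ (_ , v) → proj₁ (complete v)
    ; cong      = λ { {_ , v} {_ , w} c≗e → injective _ _ λ n →
        ≡.trans (≡.sym (proj₂ (complete v) n)) (≡.trans (c≗e n) (proj₂ (complete w) n)) }
    ; bijective =
        (λ { {_ , v} {_ , w} eq n → ≡.trans (proj₂ (complete v) n)
          (≡.trans (≡.cong (λ i → code i n) eq) (≡.sym (proj₂ (complete w) n))) }) ,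
        λ i → (code i , valid i) , λ { {_ , w} c≗ → injective _ _ λ n →
          ≡.trans (≡.sym (proj₂ (complete w) n)) (c≗ n) }
    }
    where open Enumeration enum

  module Cardinal κ {X} (card : HasCardinality (codeSetoid X) κ) where
    private
      module K = Setoid ⟦ κ ⟧
      module Card = Bijection card

    codeOf : K.Carrier → Code
    codeOf a = proj₁ (Card.to⁻ a)

    codeOf-valid : ∀ a → Valid X (codeOf a)
    codeOf-valid a = proj₂ (Card.to⁻ a)

    codeOf-injective : ∀ {a b} → codeOf a ≗ codeOf b → a K.≈ b
    codeOf-injective {a} {b} eq = K.trans (K.sym (proj₂ (Card.strictlySurjective a)))
      (K.trans (Card.cong eq) (proj₂ (Card.strictlySurjective b)))

    codeOf-complete : ∀ {c} → Valid X c → ∃ λ a → codeOf a ≗ c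
    codeOf-complete {c} v = Card.to (c , v) , Card.injective (proj₂ (Card.strictlySurjective _))

    unique⇒trivial : ∀ {c} → Unique X c → ∀ a b → a K.≈ b
    unique⇒trivial (_ , only) a b = codeOf-injective λ n →
      ≡.trans (only (codeOf-valid a) n) (≡.sym (only (codeOf-valid b) n))

  -- Many codes from repeated choices.

  Interior : Carrier → Set
  Interior X = 0# < X × X < q

  interior⇒inRange : ∀ {X} → Interior X → InRange X
  interior⇒inRange (0<X , X<q) = proj₁ 0<X , proj₁ X<q

  data Position (X : Carrier) : Set where
    bottom : 0# ≈ X → Position X
    top    : q ≈ X → Position X
    inside : Interior X → Position X

  position : ∀ {X} → InRange X → Position X
  position {X} (0≤X , X≤q) with ≤-or-> X 0# | ≤-or-> q X
  ... | inj₁ X≤0 | _        = bottom (≤-antisym 0≤X X≤0)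
  ... | inj₂ _   | inj₁ q≤X = top (≤-antisym q≤X X≤q)
  ... | inj₂ 0<X | inj₂ X<q = inside (0<X , X<q)

  data Reach (P : Carrier → Set) (X : Carrier) : Set where
    here  : P X → Reach P X
    there : Interior X → ∀ d → Reach P (step d X) → Reach P X

  record Branch (X : Carrier) : Set where
    field
      interior : Interior X
      {d d′}   : Digit
      d≢d′     : d ≢ d′
      main     : Interior (step d X)
      side     : InRange (step d′ X)

  record Fork (X : Carrier) : Set where
    field
      interior : Interior X
      {d d′}   : Digit
      d≢d′     : d ≢ d′
      main     : Interior (step d X)
      side     : Interior (step d′ X)

  module Branching (reach : ∀ {X} → Interior X → Reach Branch X) where

    advance : (s : ∃ Interior) → ∃ λ d → Interior (step d (proj₁ s))
    advance (X , inX) with reach inX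
    ... | here b                  = Branch.d b , Branch.main b
    -- Only the first digit of the path is used; the rest of the path certifies that the next point
    -- is interior again.
    ... | there _ d (here b)      = d , Branch.interior b
    ... | there _ d (there i _ _) = d , i

    open Run {S = ∃ Interior} (proj₁ ∘ advance) (λ s → _ , proj₂ (advance s)) proj₁
      (interior⇒inRange ∘ proj₂) (λ _ → refl)

    code-exists : ∀ {X} → InRange X → ∃ (Valid X)
    code-exists inX with position inX
    ... | bottom 0≈X = zeros , valid-resp 0≈X (λ _ → ≡.refl) (proj₁ unique-0)
    ... | top q≈X    = bases , valid-resp q≈X (λ _ → ≡.refl) (proj₁ unique-q)
    ... | inside i   = run (_ , i) , run-valid (_ , i)

    Family : Carrier → ℕ → Set
    Family X k = ∃ λ (f : Fin k → Code) →
      (∀ i → Valid X (f i)) × (∀ {i j} → f i ≗ f j → i ≡ j)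

    -- Each branch contributes one code through its side and asks the main successor for one code
    -- fewer. The path to the branch becomes a common prefix.
    family : ∀ k {X} → Interior X → Family X k
    family zero    _   = (λ ()) , (λ ()) , λ {}
    family (suc k) inX = extend (reach inX)
      where
      extend : ∀ {X} → Reach Branch X → Family X (suc k)
      extend (there i d ρ) = let f , valid , inj = extend ρ in
        cons d ∘ f , (λ j → valid-cons (interior⇒inRange i) (valid j)) , λ eq → inj (eq ∘ suc)
      extend {X} (here b) = g , g-valid , g-injective _ _
        where
        open Branch b
        main-family : Family (step d X) k
        main-family = family k main
        g : Fin (suc k) → Code
        g zero    = cons d′ (proj₁ (code-exists side))
        g (suc i) = cons d (proj₁ main-family i)
        g-valid : ∀ i → Valid X (g i)
        g-valid zero    = valid-cons (interior⇒inRange interior) (proj₂ (code-exists side))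
        g-valid (suc i) = valid-cons (interior⇒inRange interior) (proj₁ (proj₂ main-family) i)
        g-injective : ∀ i j → g i ≗ g j → i ≡ j
        g-injective zero    zero    _  = ≡.refl
        g-injective zero    (suc j) eq = ⊥-elim (d≢d′ (≡.sym (eq 0)))
        g-injective (suc i) zero    eq = ⊥-elim (d≢d′ (eq 0))
        g-injective (suc i) (suc j) eq = ≡.cong suc (proj₂ (proj₂ main-family) (eq ∘ suc))

    interior⇒infinite : ∀ {X k} → Interior X → ¬ HasCardinality (codeSetoid X) (finite k)
    interior⇒infinite {X} {k} inX card = ℕ.1+n≰n (Fin.injective⇒≤ {f = index} index-injective)
      where
      open Cardinal (finite k) card
      F : Family X (suc k)
      F = family (suc k) inX
      index : Fin (suc k) → Fin k
      index i = proj₁ (codeOf-complete (proj₁ (proj₂ F) i))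
      index-injective : ∀ {i j} → index i ≡ index j → i ≡ j
      index-injective {i} {j} eq = proj₂ (proj₂ F) λ n → ≡.trans
        (≡.sym (proj₂ (codeOf-complete (proj₁ (proj₂ F) i)) n))
        (≡.trans (≡.cong (λ a → codeOf a n) eq) (proj₂ (codeOf-complete (proj₁ (proj₂ F) j)) n))

  module Forking (reach : ∀ {X} → Interior X → Reach Fork X) where

    choose : ∀ {X} → Fork X → (e : Digit) → ∃ λ d → Interior (step d X) × d ≢ e
    choose b e with em {Fork.d b ≡ e}
    ... | no d≢e     = Fork.d b , Fork.main b , d≢e
    ... | yes ≡.refl = Fork.d′ b , Fork.side b , λ d′≡d → Fork.d≢d′ b (≡.sym d′≡d)

    -- At each fork the next sequence of the list is avoided.
    diagonal : ∀ {X} → Reach Fork X → (ℕ → Code) → Code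
    diagonal (there _ d ρ) e zero    = d
    diagonal (there _ d ρ) e (suc n) = diagonal ρ (λ j → e j ∘ suc) n
    diagonal (here b)      e zero    = proj₁ (choose b (e 0 0))
    diagonal (here b)      e (suc n) =
      diagonal (reach (proj₁ (proj₂ (choose b (e 0 0))))) (λ j → e (suc j) ∘ suc) n

    diagonal-valid : ∀ {X} (ρ : Reach Fork X) e → Valid X (diagonal ρ e)
    diagonal-valid (there i d ρ) e zero    = interior⇒inRange i
    diagonal-valid (there i d ρ) e (suc n) = diagonal-valid ρ _ n
    diagonal-valid (here b)      e zero    = interior⇒inRange (Fork.interior b)
    diagonal-valid (here b)      e (suc n) =
      diagonal-valid (reach (proj₁ (proj₂ (choose b (e 0 0))))) _ n

    -- The sequence with index `j` is avoided at the fork with index `j`. The position of that fork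
    -- depends on the paths in between, hence the recursion on both `j` and the path.
    diagonal-differs : ∀ j {X} (ρ : Reach Fork X) e → ∃ λ n → diagonal ρ e n ≢ e j n
    diagonal-differs j (there i d ρ) e =
      let n , differ = diagonal-differs j ρ (λ j → e j ∘ suc) in suc n , differ
    diagonal-differs zero (here b) e = 0 , proj₂ (proj₂ (choose b (e 0 0)))
    diagonal-differs (suc j) (here b) e =
      let n , differ = diagonal-differs j (reach (proj₁ (proj₂ (choose b (e 0 0))))) (λ j → e (suc j) ∘ suc)
      in suc n , differ

    interior⇒uncountable : ∀ {X} → Interior X → ¬ HasCardinality (codeSetoid X) ℵ₀
    interior⇒uncountable inX card =
      let ρ = reach inX
          j , eq = codeOf-complete (diagonal-valid ρ codeOf)
          n , differ = diagonal-differs j ρ codeOf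
      in differ (≡.sym (eq n))
      where open Cardinal ℵ₀ card

  -- Orbits that reach a choice.

  :p : ∀ {n} → Polynomial n → Polynomial n
  :p q = q :- :1

  module BelowCritical (p³≤q : p * p * p ≤ q) where

    -- Otherwise p³ ≤ q ≤ p² gives p ≤ 1 and then q ≤ 1. The inequality says p < 1 + p/q, so that
    -- the regions of digits 1 and q overlap.
    p²<q : p * p < q
    p²<q = ≰⇒> λ q≤p² → <⇒≱ 0<p (≤-by
      (proj₁ 0<p *₀ diff q≤p² +₀ diff q≤p² +₀ diff p³≤q)
      (solve 1 (λ q → :p q :* (:p q :* :p q :- q) :+ (:p q :* :p q :- q) :+ (q :- :p q :* :p q :* :p q)
        := :0 :- :p q) refl q))

    -- At the threshold qX = q + p digit q leads to q - p², and q(q - p²) = p + (q - p³) ≥ p. Thus a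
    -- jump from above the region of digit 1 never lands below it, and the orbit cannot alternate
    -- between the two outer regions.
    step-base : ∀ {X} → q + p < q * X → 0# < step base X × p ≤ q * step base X
    step-base {X} q+p<qX =
      <-by (diff⁺ q+p<qX +₁ proj₁ (diff⁺ p²<q))
        (solve 2 (λ q X → (q :* X :- (q :+ :p q)) :+ (q :- :p q :* :p q) :=
          q :* X :- :p q :* q :- :0) refl q X) ,
      ≤-by (proj₁ 0<q *₀ proj₁ (diff⁺ q+p<qX) +₀ diff p³≤q)
        (solve 2 (λ q X → q :* (q :* X :- (q :+ :p q)) :+ (q :- :p q :* :p q :* :p q) :=
          q :* (q :* X :- :p q :* q) :- :p q) refl q X)

    -- The hypothesis covers exactly the points where digit 1 is admissible. To the left digit 0 is
    -- forced and multiplies `X` by `q`; to the right digit q is forced and multiplies `q - X` by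
    -- `q`. The measures carry an extra factor `q` to keep the thresholds p/q and 1 + p/q free of
    -- divisions.
    module Outer (P : Carrier → Set)
      (center : ∀ {X} → Interior X → p ≤ q * X → q * X ≤ q + p → Reach P X) where

      reach-above : ∀ {X} → Interior X → p ≤ q * X → Reach P X
      reach-above {X} inX p≤qX = escape (λ X → q * (q - X)) (λ X → Interior X × p ≤ q * X) (Reach P)
        (q * q - (q + p))
        (λ { {X} (i , p≤) b≤ → center i p≤ (≤-by (diff b≤)
          (solve 2 (λ q X → q :* (q :- X) :- (q :* q :- (q :+ :p q)) := q :+ :p q :- q :* X) refl q X)) })
        (λ { {X} (i , _) <b →
          let 0<Y , p≤qY = step-base {X} (<-by (diff⁺ <b) (solve 2 (λ q X →
                (q :* q :- (q :+ :p q)) :- q :* (q :- X) := q :* X :- (q :+ :p q)) refl q X))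
              Y<q = <-by (0<q *₁ diff⁺ (proj₂ i))
                (solve 2 (λ q X → q :* (q :- X) := q :- (q :* X :- :p q :* q)) refl q X)
          in step base X , ((0<Y , Y<q) , p≤qY) ,
            solve 2 (λ q X → q :* (q :* (q :- X)) := q :* (q :- (q :* X :- :p q :* q))) refl q X ,
            there i base })
        (inX , p≤qX) (0<q *₁ diff⁺ (proj₂ inX))

      reach : ∀ {X} → Interior X → Reach P X
      reach {X} inX = escape (λ X → q * X) Interior (Reach P) p reach-above
        (λ {X} i <b → step zero X ,
          (<-by (0<q *₁ proj₁ i) (solve 2 (λ q X → q :* X := q :* X :- :p q :* :0 :- :0) refl q X) ,
           <-by (diff⁺ <b +₁ proj₁ 0<1)
             (solve 2 (λ q X → :p q :- q :* X :+ :1 := q :- (q :* X :- :p q :* :0)) refl q X)) ,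
          solve 2 (λ q X → q :* (q :* X) := q :* (q :* X :- :p q :* :0)) refl q X ,
          there i zero)
        inX (0<q *₁ proj₁ inX)

  branch-low : ∀ {X} → Interior X → p ≤ q * X → X ≤ 1# → Branch X
  branch-low {X} inX p≤qX X≤1 with ≤-or-> 1# X
  ... | inj₂ X<1 = record
    { interior = inX
    ; d = zero
    ; d′ = one
    ; d≢d′ = λ ()
    ; main =
        <-by (0<p +₁ diff p≤qX)
          (solve 2 (λ q X → :p q :+ (q :* X :- :p q) := q :* X :- :p q :* :0 :- :0) refl q X) ,
        <-by (0<q *₁ diff⁺ X<1)
          (solve 2 (λ q X → q :* (:1 :- X) := q :- (q :* X :- :p q :* :0)) refl q X)
    ; side =
        ≤-by (diff p≤qX)
          (solve 2 (λ q X → q :* X :- :p q := q :* X :- :p q :* :1 :- :0) refl q X) ,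
        ≤-by (proj₁ 0<q *₀ diff X≤1 +₀ proj₁ 0<p)
          (solve 2 (λ q X → q :* (:1 :- X) :+ :p q := q :- (q :* X :- :p q :* :1)) refl q X)
    }
  -- Here `X` is 1: digit 0 leads to the endpoint `q` while digit 1 stays at the fixed point, so the
  -- roles are exchanged.
  ... | inj₁ 1≤X = record
    { interior = inX
    ; d = one
    ; d′ = zero
    ; d≢d′ = λ ()
    ; main =
        <-by (0<1 +₁ (proj₁ 0<q *₀ diff 1≤X))
          (solve 2 (λ q X → :1 :+ q :* (X :- :1) := q :* X :- :p q :* :1 :- :0) refl q X) ,
        <-by (0<p +₁ (proj₁ 0<q *₀ diff X≤1))
          (solve 2 (λ q X → :p q :+ q :* (:1 :- X) := q :- (q :* X :- :p q :* :1)) refl q X)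
    ; side =
        ≤-by (proj₁ 0<p +₀ diff p≤qX)
          (solve 2 (λ q X → :p q :+ (q :* X :- :p q) := q :* X :- :p q :* :0 :- :0) refl q X) ,
        ≤-by (proj₁ 0<q *₀ diff X≤1)
          (solve 2 (λ q X → q :* (:1 :- X) := q :- (q :* X :- :p q :* :0)) refl q X)
    }

  fork-low : ∀ {X} → Interior X → p < q * X → X < 1# → Fork X
  fork-low {X} inX p<qX X<1 = record
    { interior = inX
    ; d = zero
    ; d′ = one
    ; d≢d′ = λ ()
    ; main =
        <-by (0<p +₁ proj₁ (diff⁺ p<qX))
          (solve 2 (λ q X → :p q :+ (q :* X :- :p q) := q :* X :- :p q :* :0 :- :0) refl q X) ,
        <-by (0<q *₁ diff⁺ X<1)
          (solve 2 (λ q X → q :* (:1 :- X) := q :- (q :* X :- :p q :* :0)) refl q X)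
    ; side =
        <-by (diff⁺ p<qX)
          (solve 2 (λ q X → q :* X :- :p q := q :* X :- :p q :* :1 :- :0) refl q X) ,
        <-by (0<q *₁ diff⁺ X<1 +₁ proj₁ 0<p)
          (solve 2 (λ q X → q :* (:1 :- X) :+ :p q := q :- (q :* X :- :p q :* :1)) refl q X)
    }

  fork-high : ∀ {X} → Interior X → p < X → q * X < q + p → Fork X
  fork-high {X} inX p<X qX<q+p = record
    { interior = inX
    ; d = one
    ; d′ = base
    ; d≢d′ = λ ()
    ; main =
        <-by (0<p *₁ 0<p +₁ (proj₁ 0<q *₀ proj₁ (diff⁺ p<X)))
          (solve 2 (λ q X → :p q :* :p q :+ q :* (X :- :p q) := q :* X :- :p q :* :1 :- :0) refl q X) ,
        <-by (diff⁺ qX<q+p)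
          (solve 2 (λ q X → q :+ :p q :- q :* X := q :- (q :* X :- :p q :* :1)) refl q X)
    ; side =
        <-by (0<q *₁ diff⁺ p<X)
          (solve 2 (λ q X → q :* (X :- :p q) := q :* X :- :p q :* q :- :0) refl q X) ,
        <-by (diff⁺ qX<q+p +₁ proj₁ (0<p *₁ 0<p))
          (solve 2 (λ q X → q :+ :p q :- q :* X :+ :p q :* :p q := q :- (q :* X :- :p q :* q)) refl q X)
    }

  module BranchReach (p³≤q : p * p * p ≤ q) where

    open BelowCritical p³≤q

    branch-high : ∀ {X} → Interior X → p ≤ X → q * X ≤ q + p → Branch X
    branch-high {X} inX p≤X qX≤q+p with ≤-or-> (q + p) (q * X)
    ... | inj₂ qX<q+p = record
      { interior = inX
      ; d = one
      ; d′ = base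
      ; d≢d′ = λ ()
      ; main =
          <-by (0<p *₁ 0<p +₁ (proj₁ 0<q *₀ diff p≤X))
            (solve 2 (λ q X → :p q :* :p q :+ q :* (X :- :p q) := q :* X :- :p q :* :1 :- :0) refl q X) ,
          <-by (diff⁺ qX<q+p)
            (solve 2 (λ q X → q :+ :p q :- q :* X := q :- (q :* X :- :p q :* :1)) refl q X)
      ; side =
          ≤-by (proj₁ 0<q *₀ diff p≤X)
            (solve 2 (λ q X → q :* (X :- :p q) := q :* X :- :p q :* q :- :0) refl q X) ,
          ≤-by (diff qX≤q+p +₀ proj₁ (0<p *₁ 0<p))
            (solve 2 (λ q X → q :+ :p q :- q :* X :+ :p q :* :p q := q :- (q :* X :- :p q :* q)) refl q X)
      }
    -- Here qX = q + p: digit 1 leads to the endpoint `q`, while digit q leads to q - p², which is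
    -- interior.
    ... | inj₁ q+p≤qX = record
      { interior = inX
      ; d = base
      ; d′ = one
      ; d≢d′ = λ ()
      ; main =
          <-by (diff⁺ p²<q +₁ diff q+p≤qX)
            (solve 2 (λ q X → (q :- :p q :* :p q) :+ (q :* X :- (q :+ :p q)) :=
              q :* X :- :p q :* q :- :0) refl q X) ,
          <-by (0<p *₁ 0<p +₁ diff qX≤q+p)
            (solve 2 (λ q X → :p q :* :p q :+ (q :+ :p q :- q :* X) := q :- (q :* X :- :p q :* q)) refl q X)
      ; side =
          ≤-by (diff q+p≤qX +₀ proj₁ 0<q)
            (solve 2 (λ q X → q :* X :- (q :+ :p q) :+ q := q :* X :- :p q :* :1 :- :0) refl q X) ,
          ≤-by (diff qX≤q+p)
            (solve 2 (λ q X → q :+ :p q :- q :* X := q :- (q :* X :- :p q :* :1)) refl q X)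
      }

    -- Between the two switch regions digit 1 is forced; the orbit moves away from
    -- its fixed point 1 and, because p³ ≤ q, returns after one digit q.
    reach-middle : ∀ {X} → 1# < X → X < p * p → Reach Branch X
    reach-middle {X} 1<X X<p² = escape (λ X → X - 1#) (λ X → 1# < X × X < p * p) (Reach Branch)
      (p - 1#) stop
      (λ { {X} (1<X , X<p²) <b → step one X ,
        (<-by (0<q *₁ diff⁺ 1<X)
           (solve 2 (λ q X → q :* (X :- :1) := q :* X :- :p q :* :1 :- :1) refl q X) ,
         <-by (0<q *₁ diff⁺ <b)
           (solve 2 (λ q X → q :* (:p q :- :1 :- (X :- :1)) :=
             :p q :* :p q :- (q :* X :- :p q :* :1)) refl q X)) ,
        solve 2 (λ q X → q :* (X :- :1) := q :* X :- :p q :* :1 :- :1) refl q X ,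
        there (interior 1<X X<p²) one })
      (1<X , X<p²) (diff⁺ 1<X)
      where
      interior : ∀ {X} → 1# < X → X < p * p → Interior X
      interior {X} 1<X X<p² =
        <-by (diff⁺ 1<X +₁ proj₁ 0<1) (solve 1 (λ X → X :- :1 :+ :1 := X :- :0) refl X) ,
        <-by (diff⁺ X<p² +₁ proj₁ (diff⁺ p²<q))
          (solve 2 (λ q X → :p q :* :p q :- X :+ (q :- :p q :* :p q) := q :- X) refl q X)

      stop : ∀ {X} → 1# < X × X < p * p → p - 1# ≤ X - 1# → Reach Branch X
      stop {X} (1<X , X<p²) b≤ with ≤-or-> (q * X) (q + p)
      ... | inj₁ qX≤q+p = here (branch-high (interior 1<X X<p²)
        (≤-by (diff b≤) (solve 2 (λ q X → X :- :1 :- (:p q :- :1) := X :- :p q) refl q X)) qX≤q+p)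
      ... | inj₂ q+p<qX = there (interior 1<X X<p²) base (here (branch-low (0<Y , Y<q) p≤qY Y≤1))
        where
        0<Y : 0# < step base X
        0<Y = proj₁ (step-base q+p<qX)
        p≤qY : p ≤ q * step base X
        p≤qY = proj₂ (step-base q+p<qX)
        Y≤1 : step base X ≤ 1#
        Y≤1 = ≤-by (proj₁ 0<q *₀ proj₁ (diff⁺ X<p²) +₀ diff p³≤q)
          (solve 2 (λ q X → q :* (:p q :* :p q :- X) :+ (q :- :p q :* :p q :* :p q) :=
            :1 :- (q :* X :- :p q :* q)) refl q X)
        Y<q : step base X < q
        Y<q = <-by (diff⁺ 1<q +₁ diff Y≤1)
          (solve 2 (λ q Y → q :- :1 :+ (:1 :- Y) := q :- Y) refl q (step base X))

    reach-center : ∀ {X} → Interior X → p ≤ q * X → q * X ≤ q + p → Reach Branch X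
    reach-center {X} inX p≤qX qX≤q+p with ≤-or-> X 1# | ≤-or-> p X
    ... | inj₁ X≤1 | _        = here (branch-low inX p≤qX X≤1)
    ... | inj₂ _   | inj₁ p≤X = here (branch-high inX p≤X qX≤q+p)
    ... | inj₂ 1<X | inj₂ X<p = reach-middle 1<X (<-by
      (diff⁺ X<p +₁ (proj₁ 0<p *₀ (proj₁ (diff⁺ X<p) +₀ proj₁ (diff⁺ 1<X))))
      (solve 2 (λ q X → :p q :- X :+ :p q :* (:p q :- X :+ (X :- :1)) := :p q :* :p q :- X) refl q X))

    open Outer Branch reach-center public using (reach)

  module ForkReach (p<1 : p < 1#) where

    p³≤q : p * p * p ≤ q
    p³≤q = ≤-by (proj₁ 0<1 +₀ (proj₁ 0<p *₀ proj₁ (diff⁺ p<1) *₀ proj₁ 0<q))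
      (solve 1 (λ q → :1 :+ :p q :* (:1 :- :p q) :* q := q :- :p q :* :p q :* :p q) refl q)

    -- For p < 1 the regions (p/q, 1) and (p, 1 + p/q) of the two kinds of fork cover the open
    -- center. Its ends need one more digit: digit 0 takes p/q to p, and digit q takes 1 + p/q to q
    -- - p², both of which are forks.
    reach-center : ∀ {X} → Interior X → p ≤ q * X → q * X ≤ q + p → Reach Fork X
    reach-center {X} inX p≤qX qX≤q+p with ≤-or-> (q * X) p | ≤-or-> 1# X | ≤-or-> (q + p) (q * X)
    ... | inj₁ qX≤p | _        | _           = there inX zero (here (fork-low
      (<-by (0<p +₁ diff p≤qX)
        (solve 2 (λ q X → :p q :+ (q :* X :- :p q) := q :* X :- :p q :* :0 :- :0) refl q X) ,
       <-by (0<1 +₁ diff qX≤p)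
        (solve 2 (λ q X → :1 :+ (:p q :- q :* X) := q :- (q :* X :- :p q :* :0)) refl q X))
      (<-by (0<p *₁ 0<p +₁ (proj₁ 0<q *₀ diff p≤qX))
        (solve 2 (λ q X → :p q :* :p q :+ q :* (q :* X :- :p q) :=
          q :* (q :* X :- :p q :* :0) :- :p q) refl q X))
      (<-by (diff⁺ p<1 +₁ diff qX≤p)
        (solve 2 (λ q X → :1 :- :p q :+ (:p q :- q :* X) := :1 :- (q :* X :- :p q :* :0)) refl q X))))
    ... | inj₂ p<qX | inj₂ X<1 | _           = here (fork-low inX p<qX X<1)
    ... | inj₂ _    | inj₁ 1≤X | inj₂ qX<q+p = here (fork-high inX
      (<-by (diff⁺ p<1 +₁ diff 1≤X)
        (solve 2 (λ q X → :1 :- :p q :+ (X :- :1) := X :- :p q) refl q X)) qX<q+p)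
    ... | inj₂ _    | inj₁ _   | inj₁ q+p≤qX = there inX base (here (fork-high
      (<-by (0<p +₁ proj₁ (diff⁺ p<Y))
        (solve 2 (λ p Y → p :+ (Y :- p) := Y :- :0) refl p (step base X)) ,
       <-by (0<p *₁ 0<p +₁ diff qX≤q+p)
        (solve 2 (λ q X → :p q :* :p q :+ (q :+ :p q :- q :* X) := q :- (q :* X :- :p q :* q)) refl q X))
      p<Y
      (<-by (0<p *₁ 0<p *₁ 0<p +₁ (proj₁ 0<q *₀ diff qX≤q+p))
        (solve 2 (λ q X → :p q :* :p q :* :p q :+ q :* (q :+ :p q :- q :* X) :=
          q :+ :p q :- q :* (q :* X :- :p q :* q)) refl q X))))
      where
      p<Y : p < step base X
      p<Y = <-by (diff⁺ p<1 *₁ 0<q +₁ diff q+p≤qX)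
        (solve 2 (λ q X → (:1 :- :p q) :* q :+ (q :* X :- (q :+ :p q)) :=
          q :* X :- :p q :* q :- :p q) refl q X)

    open BelowCritical p³≤q
    open Outer Fork reach-center public using (reach)

  -- Lower bounds on the base.

  𝓑-ℵ₀⇒2≤q : 𝓑 ℵ₀ q → 2# ≤ q
  𝓑-ℵ₀⇒2≤q q∈𝓑 = ≮⇒≥ λ q<2 → refute q<2 (𝓑⇒codes ℵ₀ q∈𝓑)
    where
    refute : q < 2# → ¬ (∃ λ X → ∃ (Valid X) × HasCardinality (codeSetoid X) ℵ₀)
    refute q<2 (X , (c , valid) , card) = by-position (position (valid 0))
      where
      p<1 : p < 1#
      p<1 = <-by (diff⁺ q<2) (solve 1 (λ q → :1 :+ :1 :- q := :1 :- :p q) refl q)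
      open Cardinal ℵ₀ card using (unique⇒trivial)
      open ForkReach p<1 using (reach)
      open Forking reach using (interior⇒uncountable)
      0≢1 : ¬ 0 ≡ 1
      0≢1 ()
      by-position : Position X → ⊥
      by-position (bottom 0≈X) = 0≢1 (unique⇒trivial (unique-resp 0≈X unique-0) 0 1)
      by-position (top q≈X)    = 0≢1 (unique⇒trivial (unique-resp q≈X unique-q) 0 1)
      by-position (inside inX) = interior⇒uncountable inX card

  𝓑-finite⇒p³>q : ∀ {k} → 2 ℕ.≤ k → 𝓑 (finite k) q → q < p * p * p
  𝓑-finite⇒p³>q {k} (ℕ.s≤s (ℕ.s≤s _)) q∈𝓑 = ≰⇒> λ p³≤q → refute p³≤q (𝓑⇒codes (finite k) q∈𝓑)
    where
    refute : p * p * p ≤ q → ¬ (∃ λ X → ∃ (Valid X) × HasCardinality (codeSetoid X) (finite k))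
    refute p³≤q (X , (c , valid) , card) = by-position (position (valid 0))
      where
      open Cardinal (finite k) card using (unique⇒trivial)
      open BranchReach p³≤q using (reach)
      open Branching reach using (interior⇒infinite)
      by-position : Position X → ⊥
      by-position (bottom 0≈X) = Fin.0≢1+n (unique⇒trivial (unique-resp 0≈X unique-0) zero (suc zero))
      by-position (top q≈X)    = Fin.0≢1+n (unique⇒trivial (unique-resp q≈X unique-q) zero (suc zero))
      by-position (inside inX) = interior⇒infinite inX card

  -- A continuum of codes.

  bit₀ bit₁ : Digit → Bool
  bit₀ zero = false
  bit₀ one  = false
  bit₀ base = true
  bit₁ zero = false
  bit₁ one  = true
  bit₁ base = true

  bits-injective : ∀ d e → bit₀ d ≡ bit₀ e → bit₁ d ≡ bit₁ e → d ≡ e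
  bits-injective zero zero _ _ = ≡.refl
  bits-injective one  one  _ _ = ≡.refl
  bits-injective base base _ _ = ≡.refl
  bits-injective zero one  _ ()
  bits-injective zero base () _
  bits-injective one  zero _ ()
  bits-injective one  base () _
  bits-injective base zero () _
  bits-injective base one  () _

  bits : Code → ℕ → Bool
  bits c zero          = bit₀ (c 0)
  bits c (suc zero)    = bit₁ (c 0)
  bits c (suc (suc n)) = bits (c ∘ suc) n

  bits-cong : ∀ {c e} → c ≗ e → bits c ≗ bits e
  bits-cong c≗e zero          = ≡.cong bit₀ (c≗e 0)
  bits-cong c≗e (suc zero)    = ≡.cong bit₁ (c≗e 0)
  bits-cong c≗e (suc (suc n)) = bits-cong (c≗e ∘ suc) n

  bits-reflect : ∀ {c e} → bits c ≗ bits e → c ≗ e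
  bits-reflect         eq zero    = bits-injective _ _ (eq 0) (eq 1)
  bits-reflect {c} {e} eq (suc n) = bits-reflect {c ∘ suc} {e ∘ suc} (λ m → eq (suc (suc m))) n

  blocks : (ℕ → Bool) → Code
  blocks b zero          = if b 0 then one else zero
  blocks b (suc zero)    = if b 0 then zero else base
  blocks b (suc (suc n)) = blocks (b ∘ suc) n

  blocks-cong : ∀ {b b′} → b ≗ b′ → blocks b ≗ blocks b′
  blocks-cong b≗b′ zero          = ≡.cong (if_then one else zero) (b≗b′ 0)
  blocks-cong b≗b′ (suc zero)    = ≡.cong (if_then zero else base) (b≗b′ 0)
  blocks-cong b≗b′ (suc (suc n)) = blocks-cong (b≗b′ ∘ suc) n

  blocks-reflect : ∀ {b b′} → blocks b ≗ blocks b′ → b ≗ b′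
  blocks-reflect          eq zero    = first _ _ (eq 0)
    where
    first : ∀ x y → (if x then one else zero) ≡ (if y then one else zero) → x ≡ y
    first false false _ = ≡.refl
    first true  true  _ = ≡.refl
  blocks-reflect {b} {b′} eq (suc n) = blocks-reflect {b ∘ suc} {b′ ∘ suc} (λ m → eq (suc (suc m))) n

  -- X is the rescaled value of (10)^∞.
  module Blocks where

    X : Carrier
    X = q * (q + 1#) ⁻¹

    0<q+1 : 0# < q + 1#
    0<q+1 = <-by (0<q +₁ proj₁ 0<1) (solve 1 (λ q → q :+ :1 := q :+ :1 :- :0) refl q)

    [q+1]X≈q : (q + 1#) * X ≈ q
    [q+1]X≈q = trans (solve 3 (λ a q i → a :* (q :* i) := q :* (a :* i)) refl (q + 1#) q ((q + 1#) ⁻¹))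
      (trans (*-congˡ (*-inverseʳ (<⇒≉0 0<q+1))) (*-identityʳ q))

    0<X : 0# < X
    0<X = 0<q *₁ 0<⁻¹ 0<q+1

    qX≈q-X : q * X ≈ q - X
    qX≈q-X = trans (solve 2 (λ q X → q :* X := (q :+ :1) :* X :- X) refl q X) (+-congʳ [q+1]X≈q)

    0<1-X : 0# < 1# - X
    0<1-X = *-cancelˡ-< 0<q+1 (<-by 0<1 (sym (trans
      (solve 2 (λ q X → (q :+ :1) :* (:1 :- X) :- (q :+ :1) :* :0 := q :+ :1 :- (q :+ :1) :* X) refl q X)
      (trans (+-congˡ (-‿cong [q+1]X≈q)) (solve 1 (λ q → q :+ :1 :- q := :1) refl q)))))

    X≤q : X ≤ q
    X≤q = ≤-by (proj₁ 0<1-X +₀ proj₁ 0<p)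
      (solve 2 (λ q X → :1 :- X :+ :p q := q :- X) refl q X)

    step-one : step one X ≈ 1# - X
    step-one = trans (+-congʳ qX≈q-X)
      (solve 2 (λ q X → q :- X :- :p q :* :1 := :1 :- X) refl q X)

    step-zero : step zero X ≈ q - X
    step-zero = trans (+-congʳ qX≈q-X)
      (solve 2 (λ q X → q :- X :- :p q :* :0 := q :- X) refl q X)

    q-qX≈X : q - q * X ≈ X
    q-qX≈X = trans (+-congˡ (-‿cong qX≈q-X)) (solve 2 (λ q X → q :- (q :- X) := X) refl q X)

    afterBit : Bool → Carrier
    afterBit b = step (if b then one else zero) X

    in-afterBit : ∀ b → InRange (afterBit b)
    in-afterBit true  = inRange-resp (sym step-one) (proj₁ 0<1-X ,
      ≤-by (proj₁ 0<p +₀ proj₁ 0<X) (solve 2 (λ q X → :p q :+ X := q :- (:1 :- X)) refl q X))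
    in-afterBit false = inRange-resp (sym step-zero) (diff X≤q ,
      ≤-by (proj₁ 0<X) (solve 2 (λ q X → X := q :- (q :- X)) refl q X))

    -- Both blocks have weight 1 · q + 0 = 0 · q + q, so either pair of steps takes `X` to q²X - pq,
    -- which is `X` again.
    afterBlock : ∀ b → step (if b then zero else base) (afterBit b) ≈ X
    afterBlock true  = trans (step-cong zero step-one) (trans
      (solve 2 (λ q X → q :* (:1 :- X) :- :p q :* :0 := q :- q :* X) refl q X) q-qX≈X)
    afterBlock false = trans (step-cong base step-zero) (trans
      (solve 2 (λ q X → q :* (q :- X) :- :p q :* q := q :- q :* X) refl q X) q-qX≈X)

    blocks-valid : ∀ b → Valid X (blocks b)
    blocks-valid b zero          = proj₁ 0<X , X≤q
    blocks-valid b (suc zero)    = in-afterBit (b 0)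
    blocks-valid b (suc (suc n)) =
      inRange-resp (orbit-cong (sym (afterBlock (b 0))) (λ _ → ≡.refl) n) (blocks-valid (b ∘ suc) n)

  𝓑-2^ℵ₀ : 𝓑 2^ℵ₀ q
  𝓑-2^ℵ₀ = codes⇒𝓑 2^ℵ₀ (_ , Blocks.blocks-valid (λ _ → true)) (CantorBernstein.bijection em
    (record { to = λ (c , _) → bits c ; cong = bits-cong ; injective = bits-reflect })
    (record { to = λ b → blocks b , Blocks.blocks-valid b
            ; cong = blocks-cong ; injective = blocks-reflect }))

  -- Countably many codes.

  leadingOnes : ℕ → Code
  leadingOnes zero    = cons zero bases
  leadingOnes (suc n) = cons one (leadingOnes n)

  leadingOnes-injective : ∀ m n → leadingOnes m ≗ leadingOnes n → m ≡ n
  leadingOnes-injective zero    zero    _  = ≡.refl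
  leadingOnes-injective zero    (suc n) eq with () ← eq 0
  leadingOnes-injective (suc m) zero    eq with () ← eq 0
  leadingOnes-injective (suc m) (suc n) eq =
    ≡.cong suc (leadingOnes-injective m n λ i → eq (suc i))

  -- All candidates for codes of 1, including 1ⁿq0^∞, which are valid only for q = 2. This list
  -- bounds the codes from above and `leadingOnes` bounds them from below, so q = 2 and q > 2 are
  -- treated together.
  listed : ℕ → Code
  listed zero                = ones
  listed (suc zero)          = cons zero bases
  listed (suc (suc zero))    = cons base zeros
  listed (suc (suc (suc n))) = cons one (listed (suc n))

  listed≢ones : ∀ n → ¬ listed (suc n) ≗ ones
  listed≢ones zero          eq with () ← eq 0
  listed≢ones (suc zero)    eq with () ← eq 0
  listed≢ones (suc (suc n)) eq = listed≢ones n λ i → eq (suc i)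

  listed-injective : ∀ m n → listed m ≗ listed n → m ≡ n
  listed-injective zero    zero    _  = ≡.refl
  listed-injective zero    (suc n) eq = ⊥-elim (listed≢ones n λ i → ≡.sym (eq i))
  listed-injective (suc m) zero    eq = ⊥-elim (listed≢ones m eq)
  listed-injective (suc zero)          (suc zero)          _  = ≡.refl
  listed-injective (suc zero)          (suc (suc zero))    eq with () ← eq 0
  listed-injective (suc zero)          (suc (suc (suc n))) eq with () ← eq 0
  listed-injective (suc (suc zero))    (suc zero)          eq with () ← eq 0
  listed-injective (suc (suc zero))    (suc (suc zero))    _  = ≡.refl
  listed-injective (suc (suc zero))    (suc (suc (suc n))) eq with () ← eq 0
  listed-injective (suc (suc (suc m))) (suc zero)          eq with () ← eq 0
  listed-injective (suc (suc (suc m))) (suc (suc zero))    eq with () ← eq 0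
  listed-injective (suc (suc (suc m))) (suc (suc (suc n))) eq =
    ≡.cong (λ k → suc (suc k)) (listed-injective (suc m) (suc n) λ i → eq (suc i))

  -- X = 1 is fixed by digit 1, and digit 0 leads to the endpoint q.
  module FixedPoint (2≤q : 2# ≤ q) where

    in-1 : InRange 1#
    in-1 = proj₁ 0<1 , proj₁ 1<q

    step-zero : step zero 1# ≈ q
    step-zero = solve 1 (λ q → q :* :1 :- :p q :* :0 := q) refl q

    step-one : step one 1# ≈ 1#
    step-one = solve 1 (λ q → q :* :1 :- :p q :* :1 := :1) refl q

    -- The image is q(2 - q). Digit q is thus admissible only for q = 2, and then leads to 0.
    step-base≤0 : step base 1# ≤ 0#
    step-base≤0 = ≤-by (proj₁ 0<q *₀ diff 2≤q)
      (solve 1 (λ q → q :* (q :- (:1 :+ :1)) := :0 :- (q :* :1 :- :p q :* q)) refl q)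

    leadingOnes-valid : ∀ n → Valid 1# (leadingOnes n)
    leadingOnes-valid zero    = valid-cons in-1
      (valid-resp (sym step-zero) (λ _ → ≡.refl) (proj₁ unique-q))
    leadingOnes-valid (suc n) = valid-cons in-1
      (valid-resp (sym step-one) (λ _ → ≡.refl) (leadingOnes-valid n))

    listed-complete : ∀ {c} → Valid 1# c → ∃ λ n → listed n ≗ c
    listed-complete {c} v = by-cases em
      where
      -- The position `n` of some digit other than 1 bounds the number of leading ones to be
      -- stripped.
      by-head : ∀ n {c} d → c 0 ≡ d → Valid 1# c → c n ≢ one → ∃ λ m → listed (suc m) ≗ c
      by-head n {c} zero c₀ v _ = 0 , λ
        { zero    → ≡.sym c₀
        ; (suc i) → ≡.sym (proj₂ unique-q (valid-resp step-zero (λ _ → ≡.refl) (valid-tail c₀ v)) i) }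
      by-head n {c} base c₀ v _ = 1 , λ
        { zero    → ≡.sym c₀
        ; (suc i) → ≡.sym (proj₂ unique-0 (valid-resp
            (≤-antisym step-base≤0 (proj₁ (valid-tail c₀ v 0))) (λ _ → ≡.refl) (valid-tail c₀ v)) i) }
      by-head zero    one c₀ v c₀≢1 = ⊥-elim (c₀≢1 c₀)
      by-head (suc n) {c} one c₀ v cₙ≢1 =
        let m , eq = by-head n (c 1) ≡.refl
              (valid-resp step-one (λ _ → ≡.refl) (valid-tail c₀ v)) cₙ≢1
        in suc (suc m) , λ { zero → ≡.sym c₀ ; (suc i) → eq i }

      by-cases : Dec (∃ λ n → c n ≢ one) → ∃ λ n → listed n ≗ c
      by-cases (yes (n , cₙ≢1)) = let m , eq = by-head n (c 0) ≡.refl v cₙ≢1 in suc m , eq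
      by-cases (no none) = 0 , λ n → ≡.sym (decidable-stable em λ cₙ≢1 → none (n , cₙ≢1))

    𝓑-ℵ₀ : 𝓑 ℵ₀ q
    𝓑-ℵ₀ = codes⇒𝓑 ℵ₀ (_ , leadingOnes-valid 0) (CantorBernstein.bijection em
      (record
        { to        = λ (_ , v) → proj₁ (listed-complete v)
        ; cong      = λ { {c , v} {e , w} c≗e → listed-injective _ _ λ n →
            ≡.trans (proj₂ (listed-complete v) n)
              (≡.trans (c≗e n) (≡.sym (proj₂ (listed-complete w) n))) }
        ; injective = λ { {c , v} {e , w} eq n →
            ≡.trans (≡.sym (proj₂ (listed-complete v) n))
              (≡.trans (≡.cong (λ i → listed i n) eq) (proj₂ (listed-complete w) n)) }
        })
      (record
        { to        = λ n → leadingOnes n , leadingOnes-valid n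
        ; cong      = λ { ≡.refl _ → ≡.refl }
        ; injective = leadingOnes-injective _ _
        }))

  -- Exactly k codes.

  empty-enumeration : ∀ {X} → ¬ InRange X → Enumeration X 0
  empty-enumeration out = record
    { code      = λ ()
    ; valid     = λ ()
    ; injective = λ ()
    ; complete  = λ v → ⊥-elim (out (v 0))
    }

  enumeration-resp : ∀ {X Y k} → X ≈ Y → Enumeration X k → Enumeration Y k
  enumeration-resp X≈Y enum = record
    { code      = code
    ; valid     = λ i → valid-resp X≈Y (λ _ → ≡.refl) (valid i)
    ; injective = injective
    ; complete  = λ v → complete (valid-resp (sym X≈Y) (λ _ → ≡.refl) v)
    }
    where open Enumeration enum

  enumeration-cons : ∀ {X c k} → InRange X → Unique (step zero X) c →
    Enumeration (step one X) k → ¬ InRange (step base X) → Enumeration X (suc k)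
  enumeration-cons {X} {c} {k} inX (valid₀ , only) enum out = record
    { code      = code′
    ; valid     = valid′
    ; injective = injective′
    ; complete  = λ {e} v → complete′ v (e 0) ≡.refl
    }
    where
    open Enumeration enum

    code′ : Fin (suc k) → Code
    code′ zero    = cons zero c
    code′ (suc i) = cons one (code i)

    valid′ : ∀ i → Valid X (code′ i)
    valid′ zero    = valid-cons inX valid₀
    valid′ (suc i) = valid-cons inX (valid i)

    injective′ : ∀ i j → code′ i ≗ code′ j → i ≡ j
    injective′ zero    zero    _  = ≡.refl
    injective′ zero    (suc j) eq with () ← eq 0
    injective′ (suc i) zero    eq with () ← eq 0
    injective′ (suc i) (suc j) eq = ≡.cong suc (injective i j λ n → eq (suc n))

    complete′ : ∀ {e} → Valid X e → ∀ d → e 0 ≡ d → ∃ λ i → e ≗ code′ i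
    complete′ v zero e₀ = zero , λ { zero → e₀ ; (suc n) → only (valid-tail e₀ v) n }
    complete′ v one  e₀ = let i , eq = complete (valid-tail e₀ v)
      in suc i , λ { zero → e₀ ; (suc n) → eq n }
    complete′ v base e₀ = ⊥-elim (out (valid-tail e₀ v 0))

  q[rx]≈x : ∀ x → q * (r * x) ≈ x
  q[rx]≈x x = trans (sym (*-assoc q r x)) (trans (*-congʳ qr≈1) (*-identityˡ x))

  -- The points 1 + ε rʲ are moved by digit 1 to 1 + ε rʲ⁻¹, and ε is chosen so that
  -- digit q closes the cycle at j = n + 1: this is the periodic expansion (1ⁿ⁺¹q)^∞.
  -- Since p³ > q, all points with j ≥ 1 lie below p once n is large.
  module Supercritical (q<p³ : q < p * p * p) where

    1<p : 1# < p
    1<p = ≰⇒> λ p≤1 → <⇒≱ q<p³ (≤-by (proj₁ 0<1 +₀ (proj₁ 0<p *₀ diff p≤1 *₀ proj₁ 0<q))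
      (solve 1 (λ q → :1 :+ :p q :* (:1 :- :p q) :* q := q :- :p q :* :p q :* :p q) refl q))

    g : Carrier
    g = p * p * p - q

    large : ∃ λ n → p ≤ q ^ n * g
    large = unbounded (diff⁺ q<p³) p

    n : ℕ
    n = proj₁ large

    -- Digit q takes 1 + ε to 1 + qε - p². Closing the cycle at 1 + ρε therefore means (q - ρ)ε =
    -- p².
    R ρ D ε : Carrier
    R = r ^ n
    ρ = r * R
    D = q - ρ
    ε = D ⁻¹ * (p * p)

    Rp≤g : R * p ≤ g
    Rp≤g = ≤-cong refl (r^q^* n g) (≤-by (proj₁ (0<r^ n) *₀ diff (proj₂ large))
      (solve 3 (λ R p x → R :* (x :- p) := R :* x :- R :* p) refl R p (q ^ n * g)))

    r^≤1 : ∀ j → r ^ j ≤ 1#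
    r^≤1 j = ≤-by (proj₁ (0<r^ j) *₀ diff (1≤q^ j)) (trans
      (solve 2 (λ v w → v :* (w :- :1) := v :* w :- v) refl (r ^ j) (q ^ j))
      (+-congʳ (r^q^≈1 j)))

    r<1 : r < 1#
    r<1 = *-cancelˡ-< 0<q (<-cong (sym qr≈1) (sym (*-identityʳ q)) 1<q)

    0<D : 0# < D
    0<D = <-by (0<p +₁ proj₁ (diff⁺ r<1) +₁ (proj₁ 0<r *₀ diff (r^≤1 n)))
      (solve 3 (λ q r R → :p q :+ (:1 :- r) :+ r :* (:1 :- R) := q :- r :* R :- :0) refl q r R)

    Dε≈p² : D * ε ≈ p * p
    Dε≈p² = trans (sym (*-assoc D _ _)) (trans (*-congʳ (*-inverseʳ (<⇒≉0 0<D))) (*-identityˡ _))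

    0<ε : 0# < ε
    0<ε = 0<⁻¹ 0<D *₁ (0<p *₁ 0<p)

    qε≈ : q * ε ≈ p * p + ρ * ε
    qε≈ = trans (solve 3 (λ q ρ ε → q :* ε := (q :- ρ) :* ε :+ ρ :* ε) refl q ρ ε) (+-congʳ Dε≈p²)

    -- After multiplication by Dq = q² - R the claim is p² < (q² - R)(p - 1), and the two sides
    -- differ by R + (g - Rp). This is why `n` was chosen with Rp ≤ g.
    rε<p-1 : r * ε < p - 1#
    rε<p-1 = *-cancelˡ-< (0<D *₁ 0<q) (<-by (0<r^ n +₁ diff Rp≤g) (begin
      R + (g - R * p)
        ≈⟨ solve 2 (λ q R → R :+ (:p q :* :p q :* :p q :- q :- R :* :p q) :=
             (q :* q :- R) :* (:p q :- :1) :- :p q :* :p q) refl q R ⟩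
      (q * q - R) * (p - 1#) - p * p
        ≈⟨ +-cong (*-congʳ (+-congˡ (-‿cong (q[rx]≈x R)))) (-‿cong Dε≈p²) ⟨
      (q * q - q * ρ) * (p - 1#) - D * ε
        ≈⟨ +-cong
             (solve 2 (λ q ρ → (q :* q :- q :* ρ) :* (:p q :- :1) := (q :- ρ) :* q :* (:p q :- :1)) refl q ρ)
             (-‿cong (trans (*-congˡ (sym (q[rx]≈x ε))) (sym (*-assoc D q _)))) ⟩
      D * q * (p - 1#) - D * q * (r * ε) ∎))
      where open import Relation.Binary.Reasoning.Setoid setoid

    w W : ℕ → Carrier
    w j = r ^ j * ε
    W j = 1# + w j

    0<w : ∀ j → 0# < w j
    0<w j = 0<r^ j *₁ 0<ε

    1<W : ∀ j → 1# < W j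
    1<W j = <-by (0<w j) (solve 1 (λ w → w := :1 :+ w :- :1) refl (w j))

    W<p : ∀ j → W (suc j) < p
    W<p j = <-by (diff⁺ rε<p-1 +₁ (proj₁ (0<r *₁ 0<ε) *₀ diff (r^≤1 j)))
      (solve 4 (λ p r ε v → p :- :1 :- r :* ε :+ r :* ε :* (:1 :- v) := p :- (:1 :+ r :* v :* ε))
        refl p r ε (r ^ j))

    qW : ∀ j → q * W (suc j) ≈ q + w j
    qW j = trans (solve 4 (λ q r v ε → q :* (:1 :+ r :* v :* ε) := q :+ q :* (r :* (v :* ε))) refl q r (r ^ j) ε)
      (+-congˡ (q[rx]≈x (w j)))

    qW₀ : q * W 0 ≈ q + p * p + ρ * ε
    qW₀ = trans (solve 2 (λ q ε → q :* (:1 :+ :1 :* ε) := q :+ q :* ε) refl q ε)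
      (trans (+-congˡ qε≈) (sym (+-assoc q _ _)))

    digitAt : ℕ → Digit
    digitAt zero    = base
    digitAt (suc j) = one

    next : ℕ → ℕ
    next zero    = suc n
    next (suc j) = j

    moves : ∀ j → step (digitAt j) (W j) ≈ W (next j)
    moves zero    = trans (+-congʳ qW₀)
      (solve 2 (λ q x → q :+ :p q :* :p q :+ x :- :p q :* q := :1 :+ x) refl q (ρ * ε))
    moves (suc j) = trans (+-congʳ (qW j))
      (solve 2 (λ q x → q :+ x :- :p q :* :1 := :1 :+ x) refl q (w j))

    in-W : ∀ j → InRange (W j)
    in-W zero = ≤-trans (proj₁ 0<1) (proj₁ (1<W 0)) , *-cancelˡ-≤ 0<q (≤-by
      (proj₁ 0<1 +₀ diff (≤-cong (sym (moves 0)) refl (proj₁ (W<p n))))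
      (solve 2 (λ q X → :1 :+ (:p q :- (q :* X :- :p q :* q)) := q :* q :- q :* X) refl q (W 0)))
    in-W (suc j) = ≤-trans (proj₁ 0<1) (proj₁ (1<W (suc j))) , ≤-by
      (proj₁ (diff⁺ (W<p j)) +₀ proj₁ 0<1)
      (solve 2 (λ q X → :p q :- X :+ :1 := q :- X) refl q (W (suc j)))

    forced : ∀ j → Forced (digitAt j) (W j)
    forced zero = forced-base
      (too-high (<-by (0<q *₁ diff⁺ (1<W 0))
        (solve 2 (λ q X → q :* (X :- :1) := q :* X :- :p q :* :0 :- q) refl q (W 0))))
      (too-high (<-cong refl (sym (+-congʳ qW₀)) (<-by
        (0<p *₁ diff⁺ 1<p +₁ (proj₁ 0<ρ *₀ proj₁ 0<ε))
        (solve 3 (λ q ρ ε → :p q :* (:p q :- :1) :+ ρ :* ε :=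
          q :+ :p q :* :p q :+ ρ :* ε :- :p q :* :1 :- q) refl q ρ ε))))
      where
      0<ρ : 0# < ρ
      0<ρ = 0<r *₁ 0<r^ n
    forced (suc j) = forced-one
      (too-high (<-by (0<q *₁ diff⁺ (1<W (suc j)))
        (solve 2 (λ q X → q :* (X :- :1) := q :* X :- :p q :* :0 :- q) refl q (W (suc j)))))
      (too-low (<-by (0<q *₁ diff⁺ (W<p j))
        (solve 2 (λ q X → q :* (:p q :- X) := :0 :- (q :* X :- :p q :* q)) refl q (W (suc j)))))

    open Run digitAt next W in-W moves using (run; run-unique)

    -- The map `r * x + p` undoes digit q and `r * x` undoes digit 0, so these are the points with
    -- codes qʲz and 0qʲz. The cycle is entered at `W (suc n)`, which lies below `p`: this makes
    -- digit 1 inadmissible at `V 0`.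
    Y V : ℕ → Carrier
    Y zero    = W (suc n)
    Y (suc j) = r * Y j + p
    V j = r * Y j

    y : ℕ → Code
    y zero    = run (suc n)
    y (suc j) = cons base (y j)

    r[q-Y] : ∀ x → r * (q - x) ≈ 1# - r * x
    r[q-Y] x = trans (solve 3 (λ q r x → r :* (q :- x) := q :* r :- r :* x) refl q r x) (+-congʳ qr≈1)

    in-Y : ∀ j → 1# < Y j × Y j ≤ q
    in-Y zero    = 1<W (suc n) , proj₂ (in-W (suc n))
    in-Y (suc j) = let 1<Y , Y≤q = in-Y j in
      <-by (diff⁺ 1<p +₁ (proj₁ 0<r *₀ ≤-trans (proj₁ 0<1) (proj₁ 1<Y)))
        (solve 3 (λ p r Y → p :- :1 :+ r :* Y := r :* Y :+ p :- :1) refl p r (Y j)) ,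
      ≤-by (proj₁ 0<r *₀ diff Y≤q) (trans (r[q-Y] (Y j))
        (solve 2 (λ q x → :1 :- x := q :- (x :+ :p q)) refl q (r * Y j)))

    inRange-Y : ∀ j → InRange (Y j)
    inRange-Y j = ≤-trans (proj₁ 0<1) (proj₁ (proj₁ (in-Y j))) , proj₂ (in-Y j)

    qY : ∀ j → q * Y (suc j) ≈ Y j + q * p
    qY j = trans (distribˡ q _ p) (+-congʳ (q[rx]≈x (Y j)))

    unique-Y : ∀ j → Unique (Y j) (y j)
    unique-Y zero    = run-unique forced (suc n)
    unique-Y (suc j) = unique-cons (inRange-Y (suc j))
      (forced-base
        (too-high (<-cong refl (sym (+-congʳ (qY j))) (<-by
          (0<1 +₁ proj₁ (diff⁺ 1<Y) +₁ (proj₁ 0<q *₀ proj₁ (diff⁺ 1<p)))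
          (solve 2 (λ q Y → :1 :+ (Y :- :1) :+ q :* (:p q :- :1) :=
            Y :+ q :* :p q :- :p q :* :0 :- q) refl q (Y j)))))
        (too-high (<-cong refl (sym (+-congʳ (qY j))) (<-by
          (diff⁺ 1<Y +₁ proj₁ (0<p *₁ diff⁺ 1<p))
          (solve 2 (λ q Y → Y :- :1 :+ :p q :* (:p q :- :1) :=
            Y :+ q :* :p q :- :p q :* :1 :- q) refl q (Y j))))))
      (unique-resp (sym (trans (+-congʳ (qY j))
        (solve 2 (λ q Y → Y :+ q :* :p q :- :p q :* q := Y) refl q (Y j)))) (unique-Y j))
      where
      1<Y : 1# < Y j
      1<Y = proj₁ (in-Y j)

    in-V : ∀ j → InRange (V j)
    in-V j = proj₁ 0<r *₀ proj₁ (inRange-Y j) ,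
      ≤-by (proj₁ 0<p +₀ (proj₁ 0<r *₀ diff (proj₂ (in-Y j)))) (trans (+-congˡ (r[q-Y] (Y j)))
        (solve 2 (λ q x → :p q :+ (:1 :- x) := q :- x) refl q (r * Y j)))

    step-V : ∀ d j → step d (V j) ≈ Y j - p * value d
    step-V d j = +-congʳ (q[rx]≈x (Y j))

    -- The codes of V j are the 1ⁱ 0 qʲ⁻ⁱ z with i ≤ j, where z is the unique code of Y 0.
    enumeration-V : ∀ j → Enumeration (V j) (suc j)
    enumeration-V j = enumeration-cons (in-V j)
      (unique-resp (sym (trans (step-V zero j)
        (solve 2 (λ p Y → Y :- p :* :0 := Y) refl p (Y j)))) (unique-Y j))
      (tail j)
      (too-low (<-cong (sym (step-V base j)) refl (<-by
        (0<q *₁ diff⁺ 1<p +₁ diff (proj₂ (in-Y j)))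
        (solve 2 (λ q Y → q :* (:p q :- :1) :+ (q :- Y) := :0 :- (Y :- :p q :* q)) refl q (Y j)))))
      where
      -- Digit 1 takes `V (suc j)` to `Y (suc j) - p`, which is `V j`. This is the exchange of 0q
      -- for 10, and it drives the recursion.
      tail : ∀ j → Enumeration (step one (V j)) j
      tail zero    = empty-enumeration (too-low (<-cong (sym (step-V one 0)) refl (<-by
        (diff⁺ (W<p n)) (solve 2 (λ p Y → p :- Y := :0 :- (Y :- p :* :1)) refl p (Y 0)))))
      tail (suc j) = enumeration-resp (sym (trans (step-V one (suc j))
        (solve 2 (λ p x → x :+ p :- p :* :1 := x) refl p (V j)))) (enumeration-V j)

    𝓑-finite : ∀ k → 𝓑 (finite (suc k)) q
    𝓑-finite k = codes⇒𝓑 (finite (suc k)) (_ , Enumeration.valid (enumeration-V k) zero)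
      (enumeration⇒cardinality (enumeration-V k))

-- The critical base.

module CriticalBase (em : ExcludedMiddle 0ℓ) (ℝ : CompleteOrderedField) where

  open CompleteOrderedField ℝ hiding (zero)
  open Expansions ℝ
  open IntegerCoefficients ℝ
  open OrderedField em ℝ
  open RawSemiringDefinitions (Semiring.rawSemiring semiring) using (_^_)

  1≤⇒0< : ∀ {a} → 1# ≤ a → 0# < a
  1≤⇒0< {a} 1≤a = <-by (0<1 +₁ diff 1≤a) (solve 1 (λ a → :1 :+ (a :- :1) := a :- :0) refl a)

  -- The quotient of (b³ - b) - (a³ - a) by b - a, arranged so that every term is visibly
  -- nonnegative on [1, ∞).
  cubic-factor : ∀ {a b} → 1# ≤ a → 1# ≤ b → 0# < b * b + (a * b + (a - 1#) * (a + 1#))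
  cubic-factor 1≤a 1≤b = 0<b *₁ 0<b +₁
    (proj₁ 0<a *₀ proj₁ 0<b +₀ diff 1≤a *₀ (proj₁ 0<a +₀ proj₁ 0<1))
    where
    0<a = 1≤⇒0< 1≤a
    0<b = 1≤⇒0< 1≤b

  cubic-difference : ∀ a b → (b - a) * (b * b + (a * b + (a - 1#) * (a + 1#))) ≈
    (b * b * b - b) - (a * a * a - a)
  cubic-difference = solve 2 (λ a b → (b :- a) :* (b :* b :+ (a :* b :+ (a :- :1) :* (a :+ :1))) :=
    (b :* b :* b :- b) :- (a :* a :* a :- a)) refl

  cubic-< : ∀ {a b} → 1# ≤ a → a < b → a * a * a - a < b * b * b - b
  cubic-< {a} {b} 1≤a a<b = <-by
    (diff⁺ a<b *₁ cubic-factor 1≤a (≤-trans 1≤a (proj₁ a<b))) (cubic-difference a b)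

  cubic-≤ : ∀ {a b} → 1# ≤ a → a ≤ b → a * a * a - a ≤ b * b * b - b
  cubic-≤ {a} {b} 1≤a a≤b = ≤-by
    (diff a≤b *₀ proj₁ (cubic-factor 1≤a (≤-trans 1≤a a≤b))) (cubic-difference a b)

  -- The supremum of this set will be the real root of t³ = t + 1, obtained without an intermediate
  -- value theorem. The bound 1 ≤ t selects the range where t³ - t is shown to increase.
  P : Carrier → Set
  P t = 1# ≤ t × t * t * t ≤ t + 1#

  P-bounded : UpperBound P 2#
  P-bounded {t} (_ , t³≤t+1) = ≮⇒≥ λ 2<t → <⇒≱ (cubic-< 1≤2 2<t) (≤-by
    -- The five ones are 2³ - 2 - 1.
    (diff t³≤t+1 +₀ 1≥0 +₀ 1≥0 +₀ 1≥0 +₀ 1≥0 +₀ 1≥0)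
    (solve 1 (λ t → t :+ :1 :- t :* t :* t :+ :1 :+ :1 :+ :1 :+ :1 :+ :1 :=
      (:1 :+ :1) :* (:1 :+ :1) :* (:1 :+ :1) :- (:1 :+ :1) :- (t :* t :* t :- t)) refl t))
    where
    1≥0 : 0# ≤ 1#
    1≥0 = proj₁ 0<1
    1≤2 : 1# ≤ 2#
    1≤2 = ≤-by 1≥0 (solve 0 (:1 := :1 :+ :1 :- :1) refl)

  sup : ∃ λ s → UpperBound P s × (∀ {b} → UpperBound P b → s ≤ b)
  sup = supremum P
    (1# , ≤-refl , ≤-by (proj₁ 0<1) (solve 0 (:1 := :1 :+ :1 :- :1 :* :1 :* :1) refl))
    (2# , P-bounded)

  s : Carrier
  s = proj₁ sup

  s-bounds : UpperBound P s
  s-bounds = proj₁ (proj₂ sup)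

  s-least : ∀ {b} → UpperBound P b → s ≤ b
  s-least = proj₂ (proj₂ sup)

  1≤s : 1# ≤ s
  1≤s = s-bounds (≤-refl , ≤-by (proj₁ 0<1) (solve 0 (:1 := :1 :+ :1 :- :1 :* :1 :* :1) refl))

  0<s : 0# < s
  0<s = 1≤⇒0< 1≤s

  -- C exceeds the slope of t³ - t - 1 near s, so that the sign of this function at s
  -- persists on an interval of length |s³ - s - 1| / C.
  C : Carrier
  C = 1# + (s + s + s + (s * s + s * s + s * s))

  3s+3s²≥0 : 0# ≤ s + s + s + (s * s + s * s + s * s)
  3s+3s²≥0 = s≥0 +₀ s≥0 +₀ s≥0 +₀ (s²≥0 +₀ s²≥0 +₀ s²≥0)
    where
    s≥0 = proj₁ 0<s
    s²≥0 = s≥0 *₀ s≥0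

  0<C : 0# < C
  0<C = 0<1 +₁ 3s+3s²≥0

  C[C⁻¹x]≈x : ∀ x → C * (C ⁻¹ * x) ≈ x
  C[C⁻¹x]≈x x = trans (sym (*-assoc C _ x)) (trans (*-congʳ (*-inverseʳ (<⇒≉0 0<C))) (*-identityˡ x))

  -- Otherwise `s` could be enlarged within `P`: for 0 < h ≤ 1 the cube grows by at most Ch from `s`
  -- to `s + h`, and h = g/C just uses up the slack g.
  s³≥s+1 : s + 1# ≤ s * s * s
  s³≥s+1 = ≮⇒≥ λ s³<s+1 → refute s³<s+1
    where
    refute : ¬ s * s * s < s + 1#
    refute s³<s+1 = <⇒≱ 0<h (≤-by (diff (s-bounds (1≤s+h , cubic)))
      (solve 2 (λ s h → s :- (s :+ h) := :0 :- h) refl s h))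
      where
      g h : Carrier
      g = s + 1# - s * s * s
      h = C ⁻¹ * g

      0<h : 0# < h
      0<h = 0<⁻¹ 0<C *₁ diff⁺ s³<s+1

      h≤1 : h ≤ 1#
      h≤1 = *-cancelˡ-≤ 0<C (≤-by
        (3s+3s²≥0 +₀ proj₁ 0<s *₀ diff 1≤s *₀ (proj₁ 0<s +₀ proj₁ 0<1))
        (trans (solve 1 (λ s → s :+ s :+ s :+ (s :* s :+ s :* s :+ s :* s) :+ s :* (s :- :1) :* (s :+ :1) :=
            (:1 :+ (s :+ s :+ s :+ (s :* s :+ s :* s :+ s :* s))) :* :1 :- (s :+ :1 :- s :* s :* s)) refl s)
          (+-congˡ (-‿cong (sym (C[C⁻¹x]≈x g))))))

      1≤s+h : 1# ≤ s + h
      1≤s+h = ≤-by (diff 1≤s +₀ proj₁ 0<h) (solve 2 (λ s h → s :- :1 :+ h := s :+ h :- :1) refl s h)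

      cubic : (s + h) * (s + h) * (s + h) ≤ s + h + 1#
      cubic = ≤-by
        (proj₁ 0<h *₀ (proj₁ 0<1 +₀ (s≥0 +₀ s≥0 +₀ s≥0) *₀ diff h≤1
          +₀ diff h≤1 *₀ (proj₁ 0<1 +₀ proj₁ 0<h)))
        (trans (solve 2 (λ s h →
            h :* (:1 :+ (s :+ s :+ s) :* (:1 :- h) :+ (:1 :- h) :* (:1 :+ h)) :=
            (:1 :+ (s :+ s :+ s :+ (s :* s :+ s :* s :+ s :* s))) :* h :+ s :* s :* s :-
              (s :+ h) :* (s :+ h) :* (s :+ h) :+ h) refl s h)
          (trans (+-congʳ (+-congʳ (+-congʳ (C[C⁻¹x]≈x g))))
            (solve 2 (λ s h → s :+ :1 :- s :* s :* s :+ s :* s :* s :-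
              (s :+ h) :* (s :+ h) :* (s :+ h) :+ h :=
              s :+ h :+ :1 :- (s :+ h) :* (s :+ h) :* (s :+ h)) refl s h)))
        where
        s≥0 = proj₁ 0<s

  -- Otherwise `s - h` would be a smaller upper bound: between `s - h` and `s` the function t³ - t -
  -- 1 falls by less than Ch = g from its value g at `s`, so it stays positive.
  s³≤s+1 : s * s * s ≤ s + 1#
  s³≤s+1 = ≮⇒≥ λ s+1<s³ → refute s+1<s³
    where
    refute : ¬ s + 1# < s * s * s
    refute s+1<s³ = <⇒≱ 0<h (≤-by (diff (s-least below))
      (solve 2 (λ s h → s :- h :- s := :0 :- h) refl s h))
      where
      g h : Carrier
      g = s * s * s - (s + 1#)
      h = C ⁻¹ * g

      0<h : 0# < h
      0<h = 0<⁻¹ 0<C *₁ diff⁺ s+1<s³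

      below : UpperBound P (s - h)
      below {t} Pt = ≮⇒≥ λ s-h<t → <⇒≱ (above s-h<t) (proj₂ Pt)
        where
        s-t≥0 : 0# ≤ s - t
        s-t≥0 = diff (s-bounds Pt)
        s≥0 : 0# ≤ s
        s≥0 = proj₁ 0<s
        t≥0 : 0# ≤ t
        t≥0 = proj₁ (1≤⇒0< (proj₁ Pt))
        above : s - h < t → t + 1# < t * t * t
        above s-h<t = <-by
          (0<C *₁ diff⁺ s-h<t +₁ s-t≥0 *₀ (proj₁ 0<1 +₀ proj₁ 0<1 +₀ (s≥0 +₀ s≥0 +₀ s≥0)
            +₀ s≥0 *₀ s-t≥0 +₀ s-t≥0 *₀ (s≥0 +₀ t≥0)))
          (trans (solve 3 (λ s t h →
              (:1 :+ (s :+ s :+ s :+ (s :* s :+ s :* s :+ s :* s))) :* (t :- (s :- h)) :+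
                (s :- t) :* (:1 :+ :1 :+ (s :+ s :+ s) :+ s :* (s :- t) :+ (s :- t) :* (s :+ t)) :=
              (:1 :+ (s :+ s :+ s :+ (s :* s :+ s :* s :+ s :* s))) :* h :-
                (s :* s :* s :- (s :+ :1)) :+ (t :* t :* t :- (t :+ :1))) refl s t h)
            (trans (+-congʳ (trans (+-congʳ (C[C⁻¹x]≈x g)) (-‿inverseʳ g))) (+-identityˡ _)))

  s³-s≈1 : s * s * s - s ≈ 1#
  s³-s≈1 = trans (+-congʳ (≤-antisym s³≤s+1 s³≥s+1)) (solve 1 (λ s → s :+ :1 :- s := :1) refl s)

  qc : Carrier
  qc = s + 1#

  -- With t = x - 1 the defining equation of qc reads t³ = t + 1.
  shifted : ∀ x → let t = x - 1# in x ^ 3 - 3# * x ^ 2 + 2# * x - 1# ≈ t * t * t - t - 1#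
  shifted = solve 1 (λ x → let t = x :- :1 in
    x :^ 3 :- con (+ 3) :* x :^ 2 :+ con (+ 2) :* x :- :1 := t :* t :* t :- t :- :1) refl

  qc-root : IsRoot qc
  qc-root = trans (shifted qc) (trans
    (solve 1 (λ s → let t = s :+ :1 :- :1 in t :* t :* t :- t :- :1 := s :* s :* s :- s :- :1) refl s)
    (trans (+-congʳ s³-s≈1) (-‿inverseʳ 1#)))

  -- Confines every root to t > 1, where monotonicity applies. The product t(t - 1)(t + 1) is
  -- nonpositive on [0, 1] and for t ≤ -1; in between, t³ - t is below -t, hence below 1.
  t³-t<1 : ∀ {t} → t ≤ 1# → t * t * t - t < 1#
  t³-t<1 {t} t≤1 with ≤-or-> 0# t | ≤-or-> t (- 1#)
  ... | inj₁ 0≤t | _ = <-by (0<1 +₁ (0≤t *₀ diff t≤1 *₀ (0≤t +₀ proj₁ 0<1)))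
    (solve 1 (λ t → :1 :+ t :* (:1 :- t) :* (t :+ :1) := :1 :- (t :* t :* t :- t)) refl t)
  ... | inj₂ t<0 | inj₁ t≤-1 = <-by
    (0<1 +₁ (proj₁ (diff⁺ t<0) *₀ diff t≤-1 *₀ diff t≤1))
    (solve 1 (λ t → :1 :+ (:0 :- t) :* (:- :1 :- t) :* (:1 :- t) := :1 :- (t :* t :* t :- t)) refl t)
  ... | inj₂ t<0 | inj₂ -1<t = <-by
    (diff⁺ -1<t +₁ (-t≥0 *₀ -t≥0 *₀ -t≥0))
    (solve 1 (λ t → t :- :- :1 :+ (:0 :- t) :* (:0 :- t) :* (:0 :- t) := :1 :- (t :* t :* t :- t)) refl t)
    where
    -t≥0 : 0# ≤ 0# - t
    -t≥0 = proj₁ (diff⁺ t<0)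

  qc-unique : ∀ {x} → IsRoot x → qc ≈ x
  qc-unique {x} root = trans (+-congʳ s≈t) (solve 1 (λ x → x :- :1 :+ :1 := x) refl x)
    where
    t : Carrier
    t = x - 1#

    t³-t≈1 : t * t * t - t ≈ 1#
    t³-t≈1 = trans (solve 1 (λ y → y := y :- :1 :+ :1) refl (t * t * t - t))
      (trans (+-congʳ (trans (sym (shifted x)) root)) (+-identityˡ 1#))

    1<t : 1# < t
    1<t = ≰⇒> λ t≤1 → proj₂ (t³-t<1 t≤1) t³-t≈1

    s≈t : s ≈ t
    s≈t = ≤-antisym
      (≮⇒≥ λ t<s → proj₂ (cubic-< (proj₁ 1<t) t<s) (trans t³-t≈1 (sym s³-s≈1)))
      (≮⇒≥ λ s<t → proj₂ (cubic-< 1≤s s<t) (trans s³-s≈1 (sym t³-t≈1)))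

  -- With q = p + 1 the conclusion reads p³ - p > 1 = s³ - s, so it is a comparison of `p` with `s`.
  qc<q⇒q<p³ : ∀ {q} → qc < q → let p = q - 1# in q < p * p * p
  qc<q⇒q<p³ {q} qc<q = <-by
    (diff⁺ (<-cong s³-s≈1 refl (cubic-< 1≤s (<-by (diff⁺ qc<q)
      (solve 2 (λ q s → q :- (s :+ :1) := q :- :1 :- s) refl q s)))))
    (solve 1 (λ q → let p = q :- :1 in p :* p :* p :- p :- :1 := p :* p :* p :- q) refl q)

  q<p³⇒qc<q : ∀ {q} → 1# < q → let p = q - 1# in q < p * p * p → qc < q
  q<p³⇒qc<q {q} 1<q q<p³ = ≰⇒> λ q≤qc → <⇒≱ q<p³ (p³≤q q≤qc (≤-or-> (q - 1#) 1#))
    where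
    p³≤q : q ≤ qc → q - 1# ≤ 1# ⊎ 1# < q - 1# → (q - 1#) * (q - 1#) * (q - 1#) ≤ q
    p³≤q q≤qc (inj₁ p≤1) = ≤-by
      (proj₁ 0<1 +₀ (p≥0 *₀ diff p≤1 *₀ (p≥0 +₀ proj₁ 0<1)))
      (solve 1 (λ q → let p = q :- :1 in :1 :+ p :* (:1 :- p) :* (p :+ :1) := q :- p :* p :* p) refl q)
      where
      p≥0 : 0# ≤ q - 1#
      p≥0 = diff (proj₁ 1<q)
    p³≤q q≤qc (inj₂ 1<p) = ≤-by
      (diff (≤-cong refl s³-s≈1 (cubic-≤ (proj₁ 1<p) (≤-by (diff q≤qc)
        (solve 2 (λ q s → s :+ :1 :- q := s :- (q :- :1)) refl q s)))))
      (solve 1 (λ q → let p = q :- :1 in :1 :- (p :* p :* p :- p) := q :- p :* p :* p) refl q)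

theorem1 : ExcludedMiddle 0ℓ → (ℝ : CompleteOrderedField) →
    let open CompleteOrderedField ℝ
        open Expansions ℝ
    in ∃ λ qc →
      (IsRoot qc × (∀ {y} → IsRoot y → qc ≈ y)) ×
      𝓑 2^ℵ₀ ≐ ⟨ 1# ,∞⟩ ×
      𝓑 ℵ₀ ≐ [ 2# ,∞⟩ ×
      (∀ k → 2 ℕ.≤ k → 𝓑 (finite k) ≐ ⟨ qc ,∞⟩)
theorem1 em ℝ = qc , (qc-root , qc-unique) ,
  (proj₁ , λ {q} 1<q → Base.𝓑-2^ℵ₀ em ℝ q 1<q) ,
  ((λ {q} q∈𝓑 → Base.𝓑-ℵ₀⇒2≤q em ℝ q (proj₁ q∈𝓑) q∈𝓑) ,
   λ {q} 2≤q → Base.FixedPoint.𝓑-ℵ₀ em ℝ q (1<2≤ 2≤q) 2≤q) ,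
  λ { k@(suc j) 2≤k →
    (λ {q} q∈𝓑 → q<p³⇒qc<q (proj₁ q∈𝓑) (Base.𝓑-finite⇒p³>q em ℝ q (proj₁ q∈𝓑) 2≤k q∈𝓑)) ,
    λ {q} qc<q → Base.Supercritical.𝓑-finite em ℝ q (1<q qc<q) (qc<q⇒q<p³ qc<q) j }
  where
  open CompleteOrderedField ℝ hiding (zero)
  open Expansions ℝ
  open IntegerCoefficients ℝ
  open OrderedField em ℝ
  open CriticalBase em ℝ

  1<2≤ : ∀ {q} → 2# ≤ q → 1# < q
  1<2≤ {q} 2≤q = <-by (0<1 +₁ diff 2≤q) (solve 1 (λ q → :1 :+ (q :- (:1 :+ :1)) := q :- :1) refl q)

  1<q : ∀ {q} → qc < q → 1# < q
  1<q {q} qc<q = <-by (diff⁺ qc<q +₁ proj₁ 0<s)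
    (solve 2 (λ q s → q :- (s :+ :1) :+ s := q :- :1) refl q s)
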